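{- Let $r_n:=|\mathfrak{A}_{2n+1}(2413,3142)|$ for $n\ge0$ and $R(x):=\sum_{n\ge1}r_nx^n$. Then $$R(x)=x(R(x)+1)^2+x(R(x)+1)^3.$$ Consequently $r_0=1$ and for $n\ge1$, $$r_n=\frac{2}{n}\sum_{i=0}^{n-1}2^i\binom{2n}{i}\binom{n}{i+1}.$$
   Context: $\mathfrak{A}_m(2413,3142)$ is the set of permutations $\pi$ of $[m]$ that are alternating (up-down), i.e. $\pi(1)<\pi(2)>\pi(3)<\pi(4)>\cdots$, and avoid both classical patterns $2413$ and $3142$. -}

module Defs where

open import Data.Fin.Base using (Fin; zero; suc; toℕ; _<_; punchIn)
open import Data.Fin.Permutation using (Permutation′; _⟨$⟩ʳ_; _≈_; id; insert; remove; insert-remove)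
open import Data.Fin.Properties using (_<?_; all?; any?; punchIn-injective)
open import Data.List.Base using (List; []; _∷_; length; filter; allFin; cartesianProductWith; map; upTo)
open import Data.List.Membership.Propositional.Properties using (∈-allFin)
open import Data.List.Relation.Unary.All using ([])
open import Data.List.Relation.Unary.AllPairs using ([]; _∷_)
open import Data.List.Relation.Unary.Any using (Any; here)
import Data.List.Relation.Unary.Any.Properties as Any
import Data.List.Relation.Unary.Unique.Setoid as UniqueS
import Data.List.Relation.Unary.Unique.Setoid.Properties as UniqueS
open import Data.List.Relation.Unary.Unique.Propositional.Properties using (allFin⁺)
open import Data.Nat.Base as ℕ using (ℕ; zero; suc; _+_; _*_; _∸_)
open import Data.Nat.Divisibility using (_∣_; _∣?_)
open import Data.Nat.ListAction using (sum)
import Data.Nat.Properties as ℕ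
open import Data.Product.Base using (∃; _×_; _,_)
open import Data.Vec.Base using (Vec; []; _∷_; lookup)
open import Level using (0ℓ)
open import Relation.Binary.Bundles using (Setoid)
open import Relation.Binary.PropositionalEquality using (_≡_; refl; sym; trans; cong; setoid)
open import Relation.Nullary using (Dec; ¬_)
open import Relation.Nullary.Decidable using (map′; ¬?; _×-dec_; _→-dec_)
open import Relation.Unary using (Decidable)

private
  variable
    k m : ℕ

-- Positions and values are numbered from 0, so π(1) < π(2) is an ascent at
-- even index 0.
Alternating : Permutation′ m → Set
Alternating {m} π = (i j : Fin m) → toℕ j ≡ suc (toℕ i) →
  (2 ∣ toℕ i → π ⟨$⟩ʳ i < π ⟨$⟩ʳ j) ×
  (¬ 2 ∣ toℕ i → π ⟨$⟩ʳ j < π ⟨$⟩ʳ i)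

-- A pattern is a word in one-line notation; is lists the positions of the
-- occurrence from left to right.
Occurs : Vec ℕ k → Permutation′ m → Vec (Fin m) k → Set
Occurs {k} σ π is =
  ((a b : Fin k) → a < b → lookup is a < lookup is b) ×
  ((a b : Fin k) →
    (lookup σ a ℕ.< lookup σ b → π ⟨$⟩ʳ lookup is a < π ⟨$⟩ʳ lookup is b) ×
    (π ⟨$⟩ʳ lookup is a < π ⟨$⟩ʳ lookup is b → lookup σ a ℕ.< lookup σ b))

Contains : Vec ℕ k → Permutation′ m → Set
Contains σ π = ∃ λ is → Occurs σ π is

Avoids : Vec ℕ k → Permutation′ m → Set
Avoids σ π = ¬ Contains σ π

p2413 p3142 : Vec ℕ 4
p2413 = 2 ∷ 4 ∷ 1 ∷ 3 ∷ []
p3142 = 3 ∷ 1 ∷ 4 ∷ 2 ∷ []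

𝔄 : Permutation′ m → Set
𝔄 π = Alternating π × Avoids p2413 π × Avoids p3142 π

alternating? : Decidable (Alternating {m})
alternating? π = all? λ i → all? λ j → (toℕ j ℕ.≟ suc (toℕ i)) →-dec
  (((2 ∣? toℕ i) →-dec (π ⟨$⟩ʳ i <? π ⟨$⟩ʳ j)) ×-dec
   (¬? (2 ∣? toℕ i) →-dec (π ⟨$⟩ʳ j <? π ⟨$⟩ʳ i)))

anyVec? : {P : Vec (Fin m) k → Set} → Decidable P → Dec (∃ P)
anyVec? {k = zero}  P? = map′ ([] ,_) (λ { ([] , p) → p }) (P? [])
anyVec? {k = suc k} P? = map′
  (λ { (i , is , p) → i ∷ is , p })
  (λ { (i ∷ is , p) → i , is , p })
  (any? λ i → anyVec? λ is → P? (i ∷ is))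

occurs? : (σ : Vec ℕ k) (π : Permutation′ m) → Decidable (Occurs σ π)
occurs? σ π is =
  (all? λ a → all? λ b → (a <? b) →-dec (lookup is a <? lookup is b)) ×-dec
  (all? λ a → all? λ b →
    let σ<? = lookup σ a ℕ.<? lookup σ b
        π<? = (π ⟨$⟩ʳ lookup is a) <? (π ⟨$⟩ʳ lookup is b)
    in (σ<? →-dec π<?) ×-dec (π<? →-dec σ<?))

avoids? : (σ : Vec ℕ k) → Decidable (Avoids {m = m} σ)
avoids? σ π = ¬? (anyVec? (occurs? σ π))

𝔄? : Decidable (𝔄 {m})
𝔄? π = alternating? π ×-dec avoids? p2413 π ×-dec avoids? p3142 π

-- Every permutation of Fin m, exactly once up to pointwise equality _≈_
-- (perms-complete and perms-unique below).
perms : (m : ℕ) → List (Permutation′ m)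
perms zero    = id ∷ []
perms (suc m) = cartesianProductWith (insert zero) (allFin (suc m)) (perms m)

∣𝔄∣ : ℕ → ℕ
∣𝔄∣ m = length (filter 𝔄? (perms m))

r : ℕ → ℕ
r n = ∣𝔄∣ (2 * n + 1)

permSetoid : ℕ → Setoid 0ℓ 0ℓ
permSetoid m = record
  { Carrier       = Permutation′ m
  ; _≈_           = _≈_
  ; isEquivalence = record
    { refl  = λ _ → refl
    ; sym   = λ p i → sym (p i)
    ; trans = λ p q i → trans (p i) (q i)
    }
  }

perms-complete : (π : Permutation′ m) → Any (π ≈_) (perms m)
perms-complete {zero}  π = here λ ()
perms-complete {suc m} π = Any.cartesianProductWith⁺ (insert zero)
  agree
  (∈-allFin (π ⟨$⟩ʳ zero)) (perms-complete (remove zero π))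
  where
  agree : ∀ {j ρ} → π ⟨$⟩ʳ zero ≡ j → remove zero π ≈ ρ → π ≈ insert zero j ρ
  agree refl q zero    = refl
  agree refl q (suc i) = trans (sym (insert-remove zero π (suc i)))
    (cong (punchIn (π ⟨$⟩ʳ zero)) (q i))

perms-unique : (m : ℕ) → UniqueS.Unique (permSetoid m) (perms m)
perms-unique zero    = [] ∷ []
perms-unique (suc m) = UniqueS.cartesianProductWith⁺
  (setoid (Fin (suc m))) (permSetoid m) (permSetoid (suc m)) (insert zero)
  split (allFin⁺ (suc m)) (perms-unique m)
  where
  split : ∀ {i j : Fin (suc m)} {π ρ : Permutation′ m} →
          insert zero i π ≈ insert zero j ρ → i ≡ j × π ≈ ρ
  split {i} p with p zero
  ... | refl = refl , λ l → punchIn-injective i _ _ (p (suc l))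

∑< : ℕ → (ℕ → ℕ) → ℕ
∑< n f = sum (map f (upTo n))

syntax ∑< n (λ i → e) = ∑[ i < n ] e

-- f represents the series whose coefficient of xⁿ is f n.
Series : Set
Series = ℕ → ℕ

infixl 6 _⊕_
infixl 7 _⊛_
infixr 8 _⊛^_

_⊕_ : Series → Series → Series
(f ⊕ g) n = f n + g n

_⊛_ : Series → Series → Series
(f ⊛ g) n = ∑[ i < suc n ] (f i * g (n ∸ i))

𝟙 : Series
𝟙 zero    = 1
𝟙 (suc _) = 0

_⊛^_ : Series → ℕ → Series
f ⊛^ zero  = 𝟙
f ⊛^ suc k = f ⊛ (f ⊛^ k)

x : Series
x 1 = 1
x _ = 0

-- The sum defining R starts at n = 1, so the constant term is 0, not r 0.
R : Series
R zero    = 0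
R (suc n) = r (suc n)

{-# OPTIONS --safe #-}
-- A permutation avoiding 2413 and 3142 is a direct sum or a skew sum of two shorter
-- ones (add the last entry to a shorter permutation that is already cut in two).
-- If it is also alternating, the two summands meet in an ascent or a descent
-- according to the parity of the position, so that iterating the decomposition,
-- always splitting off the first indecomposable summand, gives a binary tree
-- without labels; the trees that occur are those in which the right subtree of
-- every left subtree has an odd number of leaves.  Let T count these trees by
-- leaves, O and E be its odd and even parts, and let N count the trees that may
-- occur as left subtrees.  Then N = x + N O and T = x + N T.  Comparing even and
-- odd parts gives E = O² and then O = x + x O² + O³, which is the functional
-- equation because O = x (1 + R(x²)).  The explicit formula is Lagrange inversion
-- for R = x (1 + R)² (2 + R).
module Submission where

open import Defs
open import Algebra.Bundles using (CommutativeSemiring)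
import Algebra.Solver.Ring.NaturalCoefficients.Default as SeriesSolver
open import Algebra.Structures.Biased using (isCommutativeSemiringˡ)
open import Data.Bool.Base using (Bool; true; false; not; if_then_else_)
open import Data.Bool.Properties using (not-¬)
open import Data.Empty using (⊥)
open import Data.Fin.Base as Fin using (Fin; toℕ; fromℕ<; punchOut)
open import Data.Fin.Patterns using (0F; 1F; 2F; 3F)
open import Data.Fin.Permutation using (Permutation′; permutation; _⟨$⟩ʳ_; _⟨$⟩ˡ_; _≈_; inverseˡ; inverseʳ)
open import Data.Fin.Properties using (toℕ<n; toℕ-fromℕ<; toℕ-injective; fromℕ<-toℕ; any?; punchOut-injective; injective⇒≤; injective⇒existsPivot)
import Data.Fin.Properties as Fin
import Data.Integer.Properties as ℤ
open import Data.List.Base using (List; []; _∷_; _++_; length; filter; map; concatMap; cartesianProductWith; upTo)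
open import Data.List.Membership.Propositional using (_∈_; lose; find)
open import Data.List.Membership.Propositional.Properties using (∈-concatMap⁺; ∈-concatMap⁻; ∈-cartesianProductWith⁺; ∈-cartesianProductWith⁻; ∈-upTo⁺; ∈-upTo⁻; ∈-++⁺ʳ; ∈-++⁻)
open import Data.List.Properties using (length-++; length-map; length-removeAt′; map-applyUpTo; map-cong-local; map-upTo)
open import Data.List.Relation.Unary.All as All using (All; []; _∷_)
import Data.List.Relation.Unary.All.Properties as All
open import Data.List.Relation.Unary.AllPairs as AllPairs using (AllPairs; []; _∷_)
import Data.List.Relation.Unary.AllPairs.Properties as AllPairs
open import Data.List.Relation.Unary.Any as Any using (Any; here; there; _─_)
import Data.List.Relation.Unary.Any.Properties as Any
open import Data.List.Relation.Unary.Unique.Propositional using (Unique)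
import Data.List.Relation.Unary.Unique.Propositional.Properties as Unique
open import Data.Nat.Base using (ℕ; zero; suc; NonZero; _+_; _*_; _∸_; _^_; _≤_; _<_; z≤n; s≤s; s≤s⁻¹)
open import Data.Nat.Combinatorics using (_C_; nCk≡nC[n∸k]; nCn≡1; nCk+nC[k+1]≡[n+1]C[k+1])
open import Data.Nat.Combinatorics.Specification using (k>n⇒nCk≡0)
open import Data.Nat.Divisibility using (_∣_; divides; ∣m∣n⇒∣m+n; ∣-refl; _∣0)
open import Data.Nat.ListAction using (sum)
open import Data.Nat.Properties
open import Data.Nat.Tactic.RingSolver using (solve-∀)
open import Data.Product.Base using (∃; ∃₂; _×_; _,_; proj₁; proj₂)
open import Data.Rational.Base as ℚ using (_/_; toℚᵘ)
open import Data.Rational.Properties using (toℚᵘ-injective; toℚᵘ-fromℚᵘ; toℚᵘ-homo-*)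
open import Data.Rational.Unnormalised.Base as ℚᵘ using (mkℚᵘ; *≡*)
import Data.Rational.Unnormalised.Properties as ℚᵘ
open import Data.Sum.Base using (_⊎_; inj₁; inj₂)
open import Data.Unit.Base using (⊤; tt)
open import Data.Vec.Base as Vec using (Vec; []; _∷_; lookup)
open import Function.Base using (_∘_)
open import Level using (0ℓ)
open import Relation.Binary.Bundles using (Setoid)
open import Relation.Binary.Definitions using (tri<; tri≈; tri>)
open import Relation.Binary.PropositionalEquality hiding (isEquivalence)
import Relation.Binary.Reasoning.Setoid as SetoidReasoning
open import Relation.Nullary using (¬_; yes; no; contradiction)
open import Relation.Unary using (Decidable)

-- Signed comparisons and parity

private
  variable
    a b k m : ℕ
    y z w : ℕ

-- Below false is the opposite order, so that complementary arguments are
-- carried out once.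
Below : Bool → ℕ → ℕ → Set
Below true  y z = y < z
Below false y z = z < y

below-trans : ∀ c → Below c y z → Below c z w → Below c y w
below-trans true  p q = <-trans p q
below-trans false p q = <-trans q p

below-asym : ∀ c → Below c y z → ¬ Below c z y
below-asym true  = <-asym
below-asym false = <-asym

below-flip : ∀ c → Below c y z → Below (not c) z y
below-flip true  p = p
below-flip false p = p

-- Used to identify the signs of two cuts, or of a cut and an ascent or descent, from one pair of
-- entries that both compare.
below-sign : ∀ c d → Below c y z → Below d y z → c ≡ d
below-sign true  true  p q = refl
below-sign false false p q = refl
below-sign true  false p q = contradiction q (<-asym p)
below-sign false true  p q = contradiction q (<-asym p)

below-total : ∀ c → y ≢ z → Below c y z ⊎ Below c z y
below-total {y} {z} c y≢z with c | <-cmp y z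
... | true  | tri< p _ _ = inj₁ p
... | true  | tri≈ _ e _ = contradiction e y≢z
... | true  | tri> _ _ p = inj₂ p
... | false | tri< p _ _ = inj₂ p
... | false | tri≈ _ e _ = contradiction e y≢z
... | false | tri> _ _ p = inj₁ p

odd : ℕ → Bool
odd zero    = false
odd (suc n) = not (odd n)

odd-+-even : ∀ k n → odd n ≡ false → odd (k + n) ≡ odd k
odd-+-even zero    n e = e
odd-+-even (suc k) n e = cong not (odd-+-even k n e)

odd-+-odd : ∀ k n → odd n ≡ true → odd (k + n) ≡ not (odd k)
odd-+-odd zero    n e = e
odd-+-odd (suc k) n e = cong not (odd-+-odd k n e)

2*suc : ∀ n → 2 * suc n ≡ suc (suc (2 * n))
2*suc = solve-∀

odd-2* : ∀ n → odd (2 * n) ≡ false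
odd-2* zero    = refl
odd-2* (suc n) = trans (cong odd (2*suc n)) (cong (not ∘ not) (odd-2* n))

-- Words and their cuts

InjectiveBelow : ℕ → (ℕ → ℕ) → Set
InjectiveBelow m f = ∀ {i j} → i < m → j < m → f i ≡ f j → i ≡ j

-- c = true is the pattern 2413 and c = false its complement 3142.
SeparableBelow : ℕ → (ℕ → ℕ) → Set
SeparableBelow m f = ∀ c {i j k l} → i < j → j < k → k < l → l < m →
  Below c (f k) (f i) → Below c (f i) (f l) → ¬ Below c (f l) (f j)

AlternatingBelow : ℕ → (ℕ → ℕ) → Set
AlternatingBelow m f = ∀ {i} → suc i < m → Below (odd (suc i)) (f i) (f (suc i))

-- The word on positions `a`, ..., `b - 1` is a direct sum at `k` when `c` is `true`, a skew sum
-- when it is `false`.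
Cut : (ℕ → ℕ) → Bool → ℕ → ℕ → ℕ → Set
Cut f c a k b = ∀ {i j} → a ≤ i → i < k → k ≤ j → j < b → Below c (f i) (f j)

-- A linear search for the first position at which the disjunction falls on `Q`; `h ≡ k` means that
-- there is none.
prefix : {P Q : ℕ → Set} (k : ℕ) → a ≤ k →
  (∀ {i} → a ≤ i → i < k → P i ⊎ Q i) →
  ∃ λ h → a ≤ h × h ≤ k × (∀ {i} → a ≤ i → i < h → P i) × (h ≡ k ⊎ (h < k × Q h))
prefix {a} k a≤k d with m≤n⇒m<n∨m≡n a≤k
... | inj₂ refl = a , ≤-refl , ≤-refl , (λ p q → contradiction q (≤⇒≯ p)) , inj₁ refl
prefix {a} {P} (suc k) _ d | inj₁ (s≤s a≤k) with prefix k a≤k (λ p q → d p (m<n⇒m<1+n q))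
... | h , a≤h , h≤k , all , inj₂ (h<k , q) =
  h , a≤h , m≤n⇒m≤1+n h≤k , all , inj₂ (m<n⇒m<1+n h<k , q)
... | h , a≤h , h≤k , all , inj₁ refl with d a≤h (n<1+n h)
... | inj₂ q = h , a≤h , n≤1+n h , all , inj₂ (n<1+n h , q)
... | inj₁ p = suc h , m≤n⇒m≤1+n a≤h , ≤-refl , all′ , inj₁ refl
  where
  all′ : ∀ {i} → a ≤ i → i < suc h → P i
  all′ a≤i (s≤s i≤h) with m≤n⇒m<n∨m≡n i≤h
  ... | inj₁ i<h  = all a≤i i<h
  ... | inj₂ refl = p

module _ {m : ℕ} {f : ℕ → ℕ} (inj : InjectiveBelow m f) (sep : SeparableBelow m f) where

  compare : ∀ c {i j} → i < j → j < m → Below c (f i) (f j) ⊎ Below c (f j) (f i)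
  compare c i<j j<m = below-total c λ e → <⇒≢ i<j (inj (<-trans i<j j<m) j<m e)

  -- If some entry before the cut at k is beyond the last entry f e and a later
  -- one, also before the cut, is not, then these two, f k and f e form a
  -- forbidden pattern.  Hence the entries before k on the near side of f e form
  -- a prefix: if it is nonempty it ends in a cut of sign c, and otherwise f e is
  -- cut off with the opposite sign.
  cut-snoc : ∀ {e} c → e < m → a < k → k < e → Cut f c a k e →
    ∃₂ λ h d → a < h × h < suc e × Cut f d a h (suc e)
  cut-snoc {a} {k} {e} c e<m a<k k<e cut
    with prefix k (<⇒≤ a<k) (λ _ i<k → compare c (<-trans i<k k<e) e<m)
  ... | h , a≤h , h≤k , near , stop = answer (m≤n⇒m<n∨m≡n a≤h)
    where
    beyond : h ≡ k ⊎ (h < k × Below c (f e) (f h)) →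
      ∀ {j} → h ≤ j → j < k → Below c (f e) (f j)
    beyond (inj₁ refl) h≤j j<k = contradiction j<k (≤⇒≯ h≤j)
    beyond (inj₂ (h<k , e-h)) h≤j j<k with m≤n⇒m<n∨m≡n h≤j
    ... | inj₂ refl = e-h
    ... | inj₁ h<j with compare c (<-trans j<k k<e) e<m
    ... | inj₂ e-j = e-j
    ... | inj₁ j-e = contradiction (below-flip c j-e)
      (sep (not c) h<j j<k k<e e<m (below-flip c (cut a≤h h<k ≤-refl k<e)) (below-flip c e-h))

    far : ∀ {j} → h ≤ j → j < k → Below c (f e) (f j)
    far = beyond stop

    answer : a < h ⊎ a ≡ h → ∃₂ λ h d → a < h × h < suc e × Cut f d a h (suc e)
    answer (inj₁ a<h) = h , c , a<h , s≤s (≤-trans h≤k (<⇒≤ k<e)) , new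
      where
      new : Cut f c a h (suc e)
      new {j = j} a≤i i<h h≤j (s≤s j≤e) with m≤n⇒m<n∨m≡n j≤e | k ≤? j
      ... | inj₂ refl | _       = near a≤i i<h
      ... | inj₁ j<e  | yes k≤j = cut a≤i (<-≤-trans i<h h≤k) k≤j j<e
      ... | inj₁ j<e  | no k≰j  = below-trans c (near a≤i i<h) (far h≤j (≰⇒> k≰j))
    answer (inj₂ refl) = e , not c , <-trans a<k k<e , n<1+n e , new
      where
      new : Cut f (not c) a e (suc e)
      new {i} a≤i i<e e≤j (s≤s j≤e) with refl ← ≤-antisym j≤e e≤j | k ≤? i
      ... | yes k≤i = below-flip c (below-trans c (far ≤-refl a<k) (cut ≤-refl a<k k≤i i<e))
      ... | no k≰i  = below-flip c (far a≤i (≰⇒> k≰i))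

  -- Induction on `b`: two letters are cut between them, and `cut-snoc` turns a cut of the word
  -- without its last letter into a cut of the whole word.
  cut-exists : ∀ b → b ≤ m → suc a < b → ∃₂ λ k c → a < k × k < b × Cut f c a k b
  cut-exists {a} (suc e) e<m (s≤s a<e) with m≤n⇒m<n∨m≡n a<e
  ... | inj₁ a+1<e with cut-exists e (<⇒≤ e<m) a+1<e
  ... | k , c , a<k , k<e , cut = cut-snoc c e<m a<k k<e cut
  cut-exists {a} (suc e) e<m _ | inj₂ refl with compare true (n<1+n a) e<m
  ... | inj₁ p = e , true , n<1+n a , n<1+n e , only
    where
    only : Cut f true a e (suc e)
    only a≤i (s≤s i≤a) a<j (s≤s j≤e)
      with refl ← ≤-antisym a≤i i≤a | refl ← ≤-antisym a<j j≤e = p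
  ... | inj₂ p = e , false , n<1+n a , n<1+n e , only
    where
    only : Cut f false a e (suc e)
    only a≤i (s≤s i≤a) a<j (s≤s j≤e)
      with refl ← ≤-antisym a≤i i≤a | refl ← ≤-antisym a<j j≤e = p

-- Trees as decompositions of alternating words

data Tree : Set where
  leaf : Tree
  node : Tree → Tree → Tree

size : Tree → ℕ
size leaf       = 1
size (node s t) = size s + size t

RightOdd : Tree → Set
RightOdd leaf       = ⊤
RightOdd (node s t) = odd (size t) ≡ true

-- If the left subtree is itself a node, its cut and the cut of its parent are as far apart as its
-- right subtree has leaves, so their signs differ exactly when that number is odd. Goodness thus
-- says that every left summand is indecomposable for the sign of its node, which makes the
-- decomposition unique.
Good : Tree → Set
Good leaf       = ⊤
Good (node s t) = Good s × RightOdd s × Good t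

-- Shape f a b t: the word f a, …, f (b-1) is obtained by evaluating t, each
-- node being a direct sum or a skew sum.  In an alternating word the two halves
-- meet at position k in an ascent exactly when k is odd, so the position
-- determines which of the two it is.
data Shape (f : ℕ → ℕ) : ℕ → ℕ → Tree → Set where
  leaf : Shape f a (suc a) leaf
  node : ∀ {s t} → Shape f a k s → Shape f k b t → Cut f (odd k) a k b →
         Shape f a b (node s t)

module _ {f : ℕ → ℕ} where

  shape-size : ∀ {t} → Shape f a b t → a + size t ≡ b
  shape-size {a} leaf = +-comm a 1
  shape-size {a} (node {s = s} {t} p q _) =
    trans (sym (+-assoc a (size s) (size t))) (trans (cong (_+ size t) (shape-size p)) (shape-size q))

  shape-< : ∀ {t} → Shape f a b t → a < b
  shape-< leaf         = n<1+n _
  shape-< (node p q _) = <-trans (shape-< p) (shape-< q)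

  shape-cut-parity : ∀ {t} → Shape f k b t → odd (size t) ≡ true → odd b ≡ not (odd k)
  shape-cut-parity {k} q e = trans (cong odd (sym (shape-size q))) (odd-+-odd k _ e)

  -- The left half of some cut is decomposed first. If the root of its tree has the sign of that
  -- cut, then it also cuts the whole word, at an earlier position, and serves instead. `N` bounds
  -- the length `b - a`.
  shape-exists : ∀ {m} → InjectiveBelow m f → SeparableBelow m f → AlternatingBelow m f →
    ∀ N → a < b → b ≤ N + a → b ≤ m → ∃ λ t → Good t × Shape f a b t
  shape-exists inj sep alt zero a<b b≤a _ = contradiction a<b (≤⇒≯ b≤a)
  shape-exists {a} {b} {m} inj sep alt (suc N) a<b b≤ b≤m with m≤n⇒m<n∨m≡n a<b
  ... | inj₂ refl  = leaf , tt , leaf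
  ... | inj₁ 1+a<b with cut-exists inj sep b b≤m 1+a<b
  ... | suc k , c , a<k , k<b , cut
    -- The cut and the alternation both compare the entries at `k` and `suc k`, so the position
    -- forces the sign.
    with refl ← below-sign c (odd (suc k)) (cut (s≤s⁻¹ a<k) ≤-refl ≤-refl k<b) (alt (<-≤-trans k<b b≤m))
       | shape-exists inj sep alt N a<k (s≤s⁻¹ (≤-trans k<b b≤)) (≤-trans (<⇒≤ k<b) b≤m)
  ... | s , good-s , shape-s = join s good-s shape-s
    where
    right : ∀ {h} → a < h → h < b → ∃ λ t → Good t × Shape f h b t
    right {h} a<h h<b = shape-exists inj sep alt N h<b
      (≤-trans b≤ (≤-trans (≤-reflexive (sym (+-suc N a))) (+-monoʳ-≤ N a<h))) b≤m

    join : ∀ s → Good s → Shape f a (suc k) s → ∃ λ t → Good t × Shape f a b t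
    join leaf _ p with right a<k k<b
    ... | t , good-t , q = node leaf t , (tt , tt , good-t) , node p q cut
    join (node u v) good-uv p with odd (size v) in parity
    ... | true with right a<k k<b
    ...   | t , good-t , q = node (node u v) t , (good-uv , parity , good-t) , node p q cut
    -- Since `v` is even, the cuts at `h` and `suc k` have the same sign. One step back suffices:
    -- `u` satisfies `RightOdd` because `node u v` is good.
    join (node u v) (good-u , rodd-u , _) (node {k = h} p q cut′) | false
      with right (shape-< p) (<-trans (shape-< q) k<b)
    ...   | t , good-t , q′ = node u t , (good-u , rodd-u , good-t) , node p q′ wider
      where
      same : odd (suc k) ≡ odd h
      same = trans (cong odd (sym (shape-size q))) (odd-+-even h _ parity)
      wider : Cut f (odd h) a h b
      wider {j = j} a≤i i<h h≤j j<b with suc k ≤? j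
      ... | no  k≰j = cut′ a≤i i<h h≤j (≰⇒> k≰j)
      ... | yes k≤j = subst (λ c → Below c _ _) same (cut a≤i (<-trans i<h (shape-< q)) k≤j j<b)

  -- Both cuts compare f a with the last entry in the same way, so they have the
  -- same parity; but the word before the later cut is cut with the other parity,
  -- which the earlier cut contradicts.
  cut-≮ : ∀ {h k s t s′ t′} → Good (node s′ t′) →
    Shape f a h s → Shape f h b t → Cut f (odd h) a h b →
    Shape f a k s′ → Shape f k b t′ → Cut f (odd k) a k b → ¬ h < k
  cut-≮ good p q cut leaf q′ cut′ h<k = contradiction h<k (≤⇒≯ (shape-< p))
  cut-≮ {b = b} {h} {suc k} (_ , rodd , _) p q cut (node {k = l} p₁ q₁ cut₁) q′ cut′ (s≤s h≤k) =
    not-¬ (trans k≡h h≡l) (shape-cut-parity q₁ rodd)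
    where
    k≡h : odd (suc k) ≡ odd h
    k≡h with s≤s k<e ← shape-< q′ = below-sign _ _
      (cut′ ≤-refl (<-trans (shape-< p₁) (shape-< q₁)) k<e ≤-refl)
      (cut ≤-refl (shape-< p) (≤-trans h≤k (<⇒≤ k<e)) ≤-refl)
    h≡l : odd h ≡ odd l
    h≡l = below-sign _ _ (cut ≤-refl (shape-< p) h≤k (<-trans (n<1+n k) (shape-< q′)))
      (cut₁ ≤-refl (shape-< p₁) (s≤s⁻¹ (shape-< q₁)) ≤-refl)

  -- `cut-≮` in both directions forces the two roots to cut at the same position.
  shape-unique : ∀ {t t′} → Good t → Good t′ → Shape f a b t → Shape f a b t′ → t ≡ t′
  shape-unique _ _ leaf leaf = refl
  shape-unique _ _ leaf (node p q _) = contradiction (shape-< q) (≤⇒≯ (shape-< p))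
  shape-unique _ _ (node p q _) leaf = contradiction (shape-< q) (≤⇒≯ (shape-< p))
  shape-unique g@(gs , _ , gt) g′@(gs′ , _ , gt′) (node {k = h} p q cut) (node {k = k} p′ q′ cut′)
    with <-cmp h k
  ... | tri< h<k _ _  = contradiction h<k (cut-≮ g′ p q cut p′ q′ cut′)
  ... | tri> _ _ k<h  = contradiction k<h (cut-≮ g p′ q′ cut′ p q cut)
  ... | tri≈ _ refl _ = cong₂ node (shape-unique gs gs′ p p′) (shape-unique gt gt′ q q′)

  -- Two consecutive entries are separated by the node that cuts at `suc i`, whose sign is
  -- `odd (suc i)`.
  shape-alternating : ∀ {t} → Shape f a b t → ∀ {i} → a ≤ i → suc i < b →
    Below (odd (suc i)) (f i) (f (suc i))
  shape-alternating leaf a≤i (s≤s i<a) = contradiction i<a (≤⇒≯ a≤i)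
  shape-alternating (node {k = k} p q cut) {i} a≤i i<b with <-cmp (suc i) k
  ... | tri< i<k _ _  = shape-alternating p a≤i i<k
  ... | tri≈ _ refl _ = cut a≤i ≤-refl ≤-refl i<b
  ... | tri> _ _ k≤i  = shape-alternating q (s≤s⁻¹ k≤i) i<b

  -- A cut that separates `i` from `l` has sign `c`, because it compares `f i` with `f l`. If `j`
  -- lies before the cut, it orders `f j` and `f l` against the pattern; otherwise `k` lies after
  -- it, and it orders `f i` and `f k` against the pattern.
  shape-separable : ∀ {t} → Shape f a b t → ∀ c {i j k l} → a ≤ i → i < j → j < k → k < l → l < b →
    Below c (f k) (f i) → Below c (f i) (f l) → ¬ Below c (f l) (f j)
  shape-separable leaf c a≤i i<j j<k k<l (s≤s l≤a) _ _ _ =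
    <⇒≱ (<-trans i<j (<-trans j<k k<l)) (≤-trans l≤a a≤i)
  shape-separable {a} {b} (node {k = h} p q cut) c {i} {j} {k} {l} a≤i i<j j<k k<l l<b ki il lj
    with l <? h
  ... | yes l<h = shape-separable p c a≤i i<j j<k k<l l<h ki il lj
  ... | no l≮h with h ≤? i
  ... | yes h≤i = shape-separable q c h≤i i<j j<k k<l l<b ki il lj
  ... | no h≰i = between (j <? h)
    where
    i<h = ≰⇒> h≰i
    h≤l = ≮⇒≥ l≮h
    sign : odd h ≡ c
    sign = below-sign _ _ (cut a≤i i<h h≤l l<b) il
    forth : ∀ {i j} → a ≤ i → i < h → h ≤ j → j < b → Below c (f i) (f j)
    forth rewrite sym sign = cut
    between : _ → ⊥
    between (yes j<h) = below-asym c lj (forth (≤-trans a≤i (<⇒≤ i<j)) j<h h≤l l<b)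
    between (no j≮h)  = below-asym c ki
      (forth a≤i i<h (≤-trans (≮⇒≥ j≮h) (<⇒≤ j<k)) (<-trans k<l l<b))

  shape-≢ : ∀ {t} → Shape f a b t → ∀ {i j} → a ≤ i → i < j → j < b → f i ≢ f j
  shape-≢ leaf a≤i i<j (s≤s j≤a) _ = <⇒≱ i<j (≤-trans j≤a a≤i)
  shape-≢ (node {k = k} p q cut) {i} {j} a≤i i<j j<b e with j <? k | k ≤? i
  ... | yes j<k | _       = shape-≢ p a≤i i<j j<k e
  ... | no _    | yes k≤i = shape-≢ q k≤i i<j j<b e
  ... | no j≮k  | no k≰i  = irrefl (odd k) e (cut a≤i (≰⇒> k≰i) (≮⇒≥ j≮k) j<b)
    where
    irrefl : ∀ c {u v} → u ≡ v → ¬ Below c u v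
    irrefl true  refl = <-irrefl refl
    irrefl false refl = <-irrefl refl

-- The comparison of `i` and `j` is the sign of the node separating them, and the position of that
-- node depends on `a` and the tree alone. Hence the tree determines the word up to order
-- isomorphism.
shape-order : ∀ {f g t} → Shape f a b t → Shape g a b t →
  ∀ {i j} → a ≤ i → i < j → j < b → ∃ λ c → Below c (f i) (f j) × Below c (g i) (g j)
shape-order leaf _ a≤i i<j (s≤s j≤a) = contradiction (≤-trans j≤a a≤i) (<⇒≱ i<j)
shape-order (node {k = k} p q cut) (node {k = k′} p′ q′ cut′) {i} {j} a≤i i<j j<b
  with refl ← trans (sym (shape-size p)) (shape-size p′) | j <? k | k ≤? i
... | yes j<k | _       = shape-order p p′ a≤i i<j j<k
... | no _    | yes k≤i = shape-order q q′ k≤i i<j j<b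
... | no j≮k  | no k≰i  = odd k , cut a≤i (≰⇒> k≰i) (≮⇒≥ j≮k) j<b , cut′ a≤i (≰⇒> k≰i) (≮⇒≥ j≮k) j<b

shape-cong : ∀ {f g t} → (∀ {i} → a ≤ i → i < b → f i ≡ g i) → Shape f a b t → Shape g a b t
shape-cong eq leaf = leaf
shape-cong {f = f} {g} eq (node {k = k} p q cut) = node
  (shape-cong (λ a≤i i<k → eq a≤i (<-trans i<k (shape-< q))) p)
  (shape-cong (λ k≤i i<b → eq (≤-trans (<⇒≤ (shape-< p)) k≤i) i<b) q)
  (λ a≤i i<k k≤j j<b → subst₂ (Below (odd k)) (eq a≤i (<-≤-trans i<k (≤-trans k≤j (<⇒≤ j<b))))
    (eq (≤-trans (<⇒≤ (shape-< p)) k≤j) j<b) (cut a≤i i<k k≤j j<b))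

-- Trees and permutations

splice : ℕ → (ℕ → ℕ) → (ℕ → ℕ) → ℕ → ℕ
splice k f g i with i <? k
... | yes _ = f i
... | no  _ = g i

splice-< : ∀ {k f g i} → i < k → splice k f g i ≡ f i
splice-< {k} {i = i} i<k with i <? k
... | yes _   = refl
... | no  i≮k = contradiction i<k i≮k

splice-≥ : ∀ {k f g i} → k ≤ i → splice k f g i ≡ g i
splice-≥ {k} {i = i} k≤i with i <? k
... | yes i<k = contradiction i<k (≤⇒≯ k≤i)
... | no  _   = refl

Ranges : (ℕ → ℕ) → ℕ → ℕ → ℕ → ℕ → Set
Ranges f a b l h = ∀ {i} → a ≤ i → i < b → l ≤ f i × f i < h

-- The two subtrees receive adjacent intervals of values, the left one the lower interval exactly
-- when the position of the root cut is odd.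
realise : ∀ t a l → ∃ λ f → Shape f a (a + size t) t × Ranges f a (a + size t) l (l + size t)
realise leaf a l = (λ _ → l) , subst (λ b → Shape (λ _ → l) a b leaf) (+-comm 1 a) leaf ,
  λ _ _ → ≤-refl , ≤-reflexive (+-comm 1 l)
realise (node s t) a l = subst
  (λ b → ∃ λ f → Shape f a b (node s t) × Ranges f a b l (l + (size s + size t)))
  (+-assoc a (size s) (size t)) (glue (odd h) refl)
  where
  h = a + size s
  glue : ∀ c → odd h ≡ c → ∃ λ f → Shape f a (h + size t) (node s t) ×
    Ranges f a (h + size t) l (l + (size s + size t))
  glue true e with f , p , rf ← realise s a l | g , q , rg ← realise t h (l + size s) =
    splice h f g ,
    node (shape-cong (λ _ i<h → sym (splice-< i<h)) p) (shape-cong (λ h≤i _ → sym (splice-≥ h≤i)) q)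
      (λ a≤i i<h h≤j j<b → subst₂ (Below (odd h)) (sym (splice-< i<h)) (sym (splice-≥ h≤j))
        (subst (λ c → Below c _ _) (sym e) (<-≤-trans (proj₂ (rf a≤i i<h)) (proj₁ (rg h≤j j<b))))) ,
    range
    where
    range : Ranges (splice h f g) a (h + size t) l (l + (size s + size t))
    range {i} a≤i i<b with i <? h
    ... | yes i<h = proj₁ (rf a≤i i<h) ,
      <-≤-trans (proj₂ (rf a≤i i<h)) (+-monoʳ-≤ l (m≤m+n (size s) (size t)))
    ... | no i≮h = ≤-trans (m≤m+n l (size s)) (proj₁ (rg (≮⇒≥ i≮h) i<b)) ,
      <-≤-trans (proj₂ (rg (≮⇒≥ i≮h) i<b)) (≤-reflexive (+-assoc l (size s) (size t)))
  glue false e with f , p , rf ← realise s a (l + size t) | g , q , rg ← realise t h l =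
    splice h f g ,
    node (shape-cong (λ _ i<h → sym (splice-< i<h)) p) (shape-cong (λ h≤i _ → sym (splice-≥ h≤i)) q)
      (λ a≤i i<h h≤j j<b → subst₂ (Below (odd h)) (sym (splice-< i<h)) (sym (splice-≥ h≤j))
        (subst (λ c → Below c _ _) (sym e) (<-≤-trans (proj₂ (rg h≤j j<b)) (proj₁ (rf a≤i i<h))))) ,
    range
    where
    range : Ranges (splice h f g) a (h + size t) l (l + (size s + size t))
    range {i} a≤i i<b with i <? h
    ... | yes i<h = ≤-trans (m≤m+n l (size t)) (proj₁ (rf a≤i i<h)) ,
      <-≤-trans (proj₂ (rf a≤i i<h)) (≤-reflexive
        (trans (+-assoc l (size t) (size s)) (cong (l +_) (+-comm (size t) (size s)))))
    ... | no i≮h = proj₁ (rg (≮⇒≥ i≮h) i<b) ,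
      <-≤-trans (proj₂ (rg (≮⇒≥ i≮h) i<b)) (+-monoʳ-≤ l (m≤n+m (size t) (size s)))

-- If `v` were missed, punching it out would inject `Fin (suc m)` into `Fin m`.
injective⇒surjective : {g : Fin m → Fin m} → (∀ {i j} → g i ≡ g j → i ≡ j) →
  ∀ v → ∃ λ i → g i ≡ v
injective⇒surjective {suc m} {g} inj v with any? (λ i → g i Fin.≟ v)
... | yes hit = hit
... | no miss = contradiction
  (injective⇒≤ {f = λ i → punchOut (v≢g i)} λ {i} {j} e → inj (punchOut-injective (v≢g i) (v≢g j) e))
  1+n≰n
  where
  v≢g : ∀ i → v ≢ g i
  v≢g i e = miss (i , sym e)

injective⇒permutation : (g : Fin m → Fin m) → (∀ {i j} → g i ≡ g j → i ≡ j) →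
  ∃ λ (π : Permutation′ m) → ∀ i → π ⟨$⟩ʳ i ≡ g i
injective⇒permutation g inj = permutation g (proj₁ ∘ surj) (proj₂ ∘ surj)
  (λ i → inj (proj₂ (surj (g i)))) , λ _ → refl
  where surj = injective⇒surjective inj

-- The value at positions i ≥ m is irrelevant.
word : Permutation′ m → ℕ → ℕ
word {m} π i with i <? m
... | yes i<m = toℕ (π ⟨$⟩ʳ fromℕ< i<m)
... | no _    = 0

word-toℕ : (π : Permutation′ m) (i : Fin m) → word π (toℕ i) ≡ toℕ (π ⟨$⟩ʳ i)
word-toℕ {m} π i with toℕ i <? m
... | yes p = cong (λ j → toℕ (π ⟨$⟩ʳ j)) (fromℕ<-toℕ i p)
... | no ¬p = contradiction (toℕ<n i) ¬p

finite : ∀ {i} → i < m → ∃ λ (j : Fin m) → toℕ j ≡ i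
finite i<m = fromℕ< i<m , toℕ-fromℕ< i<m

word-injective : (π : Permutation′ m) → InjectiveBelow m (word π)
word-injective π i<m j<m e with i , refl ← finite i<m | j , refl ← finite j<m =
  cong toℕ (trans (sym (inverseˡ π)) (trans (cong (π ⟨$⟩ˡ_) (toℕ-injective
    (trans (sym (word-toℕ π i)) (trans e (word-toℕ π j))))) (inverseˡ π)))

word-cong : {π ρ : Permutation′ m} → π ≈ ρ → ∀ {i} → i < m → word π i ≡ word ρ i
word-cong {π = π} {ρ} π≈ρ i<m with i , refl ← finite i<m =
  trans (word-toℕ π i) (trans (cong toℕ (π≈ρ i)) (sym (word-toℕ ρ i)))

shape-injective : ∀ {f t} → Shape f 0 m t → InjectiveBelow m f
shape-injective shape {i} {j} i<m j<m e with <-cmp i j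
... | tri< i<j _ _ = contradiction e (shape-≢ shape z≤n i<j j<m)
... | tri≈ _ i≡j _ = i≡j
... | tri> _ _ j<i = contradiction (sym e) (shape-≢ shape z≤n j<i i<m)

realise-permutation : ∀ t → ∃ λ (π : Permutation′ (size t)) → Shape (word π) 0 (size t) t
realise-permutation t with f , shape , range ← realise t 0 0 =
  proj₁ perm , shape-cong (λ _ → agree) shape
  where
  g : Fin (size t) → Fin (size t)
  g i = fromℕ< (proj₂ (range z≤n (toℕ<n i)))
  toℕ-g : ∀ i → toℕ (g i) ≡ f (toℕ i)
  toℕ-g i = toℕ-fromℕ< _
  perm = injective⇒permutation g λ {i} {j} e → toℕ-injective (shape-injective shape (toℕ<n i) (toℕ<n j)
    (trans (sym (toℕ-g i)) (trans (cong toℕ e) (toℕ-g j))))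
  agree : ∀ {i} → i < size t → f i ≡ word (proj₁ perm) i
  agree i<m with i , refl ← finite i<m =
    sym (trans (word-toℕ (proj₁ perm) i) (trans (cong toℕ (proj₂ perm i)) (toℕ-g i)))

-- An injection cannot send all positions up to `i` to values below `i`, so some `j` at most `i` has
-- `g j` at least `i`; monotonicity carries this over to `g i`.
mono⇒≥ : {g : Fin m → Fin m} → (∀ {i j} → i Fin.< j → g i Fin.< g j) → ∀ i → i Fin.≤ g i
mono⇒≥ {g = g} mono i =
  let _ , j≤i , i≤gj = injective⇒existsPivot inj i in ≤-trans i≤gj (mono≤ j≤i)
  where
  inj : ∀ {i j} → g i ≡ g j → i ≡ j
  inj {i} {j} e with Fin.<-cmp i j
  ... | tri< i<j _ _ = contradiction (cong toℕ e) (<⇒≢ (mono i<j))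
  ... | tri≈ _ i≡j _ = i≡j
  ... | tri> _ _ j<i = contradiction (cong toℕ (sym e)) (<⇒≢ (mono j<i))
  mono≤ : ∀ {i j} → i Fin.≤ j → g i Fin.≤ g j
  mono≤ i≤j with m≤n⇒m<n∨m≡n i≤j
  ... | inj₁ i<j = <⇒≤ (mono i<j)
  ... | inj₂ i≡j = ≤-reflexive (cong (toℕ ∘ g) (toℕ-injective i≡j))

-- `ρ` after the inverse of `π` is monotone, so `mono⇒≥` applies to it at the value `π ⟨$⟩ʳ i`.
-- Exchanging `π` and `ρ` later gives equality.
orderIso⇒≤ : (π ρ : Permutation′ m) →
  (∀ {i j} → π ⟨$⟩ʳ i Fin.< π ⟨$⟩ʳ j → ρ ⟨$⟩ʳ i Fin.< ρ ⟨$⟩ʳ j) →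
  ∀ i → π ⟨$⟩ʳ i Fin.≤ ρ ⟨$⟩ʳ i
orderIso⇒≤ π ρ iso i = subst (λ j → π ⟨$⟩ʳ i Fin.≤ ρ ⟨$⟩ʳ j) (inverseˡ π)
  (mono⇒≥ {g = λ v → ρ ⟨$⟩ʳ (π ⟨$⟩ˡ v)}
    (λ u<v → iso (subst₂ Fin._<_ (sym (inverseʳ π)) (sym (inverseʳ π)) u<v)) (π ⟨$⟩ʳ i))

shape⇒≤ : ∀ {t} (π ρ : Permutation′ m) → Shape (word π) 0 m t → Shape (word ρ) 0 m t →
  ∀ i → π ⟨$⟩ʳ i Fin.≤ ρ ⟨$⟩ʳ i
shape⇒≤ {m} π ρ p q = orderIso⇒≤ π ρ λ {i} {j} lt →
  subst₂ _<_ (word-toℕ ρ i) (word-toℕ ρ j)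
    (iso i j (subst₂ _<_ (sym (word-toℕ π i)) (sym (word-toℕ π j)) lt))
  where
  iso : (i j : Fin m) → word π (toℕ i) < word π (toℕ j) → word ρ (toℕ i) < word ρ (toℕ j)
  iso i j lt with <-cmp (toℕ i) (toℕ j)
  ... | tri≈ _ e _ = contradiction (cong (word π) e) (<⇒≢ lt)
  ... | tri< i<j _ _ with shape-order p q z≤n i<j (toℕ<n j)
  ...   | c , πij , ρij with refl ← below-sign c true πij lt = ρij
  iso i j lt | tri> _ _ j<i with shape-order p q z≤n j<i (toℕ<n i)
  ...   | c , πji , ρji with refl ← below-sign c false πji lt = ρji

shape⇒≈ : ∀ {t} (π ρ : Permutation′ m) → Shape (word π) 0 m t → Shape (word ρ) 0 m t → π ≈ ρ
shape⇒≈ π ρ p q i = Fin.≤-antisym (shape⇒≤ π ρ p q i) (shape⇒≤ ρ π q p i)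

-- Alternation and pattern avoidance in terms of words

odd≡false⇒2∣ : ∀ n → odd n ≡ false → 2 ∣ n
odd≡true⇒2∣1+ : ∀ n → odd n ≡ true → 2 ∣ suc n
odd≡false⇒2∣ zero    _ = 2 ∣0
odd≡false⇒2∣ (suc n) e with odd n in e′
... | true = odd≡true⇒2∣1+ n e′
odd≡true⇒2∣1+ (suc n) e with odd n in e′
... | false = ∣m∣n⇒∣m+n ∣-refl (odd≡false⇒2∣ n e′)

2∣⇒odd≡false : ∀ {n} → 2 ∣ n → odd n ≡ false
2∣⇒odd≡false (divides q refl) = trans (cong odd (*-comm q 2)) (odd-2* q)

alternating⇒ : (π : Permutation′ m) → Alternating π → AlternatingBelow m (word π)
alternating⇒ {m} π alt {i} i+1<m
  with i , refl ← finite (<-trans (n<1+n i) i+1<m) | j , e ← finite i+1<m =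
  subst₂ (Below (not (odd (toℕ i)))) (sym (word-toℕ π i))
    (trans (sym (word-toℕ π j)) (cong (word π) e)) step
  where
  step : Below (not (odd (toℕ i))) (toℕ (π ⟨$⟩ʳ i)) (toℕ (π ⟨$⟩ʳ j))
  step with odd (toℕ i) in parity | alt i j e
  ... | false | up , _   = up (odd≡false⇒2∣ _ parity)
  ... | true  | _ , down = down λ 2∣i → contradiction (trans (sym parity) (2∣⇒odd≡false 2∣i)) λ ()

⇒alternating : (π : Permutation′ m) → AlternatingBelow m (word π) → Alternating π
⇒alternating {m} π alt i j e = up , down
  where
  step : Below (not (odd (toℕ i))) (toℕ (π ⟨$⟩ʳ i)) (toℕ (π ⟨$⟩ʳ j))
  step = subst₂ (Below (not (odd (toℕ i)))) (word-toℕ π i)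
    (trans (cong (word π) (sym e)) (word-toℕ π j)) (alt (subst (_< m) e (toℕ<n j)))
  up : 2 ∣ toℕ i → π ⟨$⟩ʳ i Fin.< π ⟨$⟩ʳ j
  up 2∣i with odd (toℕ i) | 2∣⇒odd≡false 2∣i | step
  ... | false | _ | p = p
  down : ¬ 2 ∣ toℕ i → π ⟨$⟩ʳ j Fin.< π ⟨$⟩ʳ i
  down 2∤i with odd (toℕ i) in parity | step
  ... | true  | p = p
  ... | false | _ = contradiction (odd≡false⇒2∣ _ parity) 2∤i

Increasing : Vec (Fin m) 4 → Set
Increasing vs = ∀ a b → a Fin.< b → lookup vs a Fin.< lookup vs b

increasing : {u v w z : Fin m} → u Fin.< v → v Fin.< w → w Fin.< z →
  Increasing (u ∷ v ∷ w ∷ z ∷ [])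
increasing p q r 0F 1F _ = p
increasing p q r 0F 2F _ = <-trans p q
increasing p q r 0F 3F _ = <-trans p (<-trans q r)
increasing p q r 1F 2F _ = q
increasing p q r 1F 3F _ = <-trans q r
increasing p q r 2F 3F _ = r
increasing p q r 1F 1F (s≤s ())
increasing p q r 2F 1F (s≤s ())
increasing p q r 2F 2F (s≤s (s≤s ()))
increasing p q r 3F 1F (s≤s ())
increasing p q r 3F 2F (s≤s (s≤s ()))
increasing p q r 3F 3F (s≤s (s≤s (s≤s ())))

increasing⁻ : {vs : Vec (Fin m) 4} → Increasing vs →
  ∀ {a b} → lookup vs a Fin.< lookup vs b → a Fin.< b
increasing⁻ inc {a} {b} lt with Fin.<-cmp a b
... | tri< a<b _ _  = a<b
... | tri≈ _ refl _ = contradiction lt (<-irrefl refl)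
... | tri> _ _ b<a  = contradiction lt (<-asym (inc _ _ b<a))

-- `rank` is the pattern counted from 0 and `vs` lists the values of the occurrence in increasing
-- order, so an occurrence reduces to two chains of three inequalities.
contains : (σ : Vec ℕ 4) (π : Permutation′ m) (is vs : Vec (Fin m) 4) (rank : Fin 4 → Fin 4) →
  (∀ a → lookup σ a ≡ suc (toℕ (rank a))) → (∀ a → π ⟨$⟩ʳ lookup is a ≡ lookup vs (rank a)) →
  Increasing is → Increasing vs → Contains σ π
contains σ π is vs rank σ≡ π≡ inc-is inc-vs = is , inc-is , λ a b →
  (λ lt → subst₂ Fin._<_ (sym (π≡ a)) (sym (π≡ b))
    (inc-vs _ _ (s≤s⁻¹ (subst₂ _<_ (σ≡ a) (σ≡ b) lt)))) ,
  (λ lt → subst₂ _<_ (sym (σ≡ a)) (sym (σ≡ b))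
    (s≤s (increasing⁻ {vs = vs} inc-vs (subst₂ Fin._<_ (π≡ a) (π≡ b) lt))))

avoids⇒separable : (π : Permutation′ m) → Avoids p2413 π → Avoids p3142 π → SeparableBelow m (word π)
avoids⇒separable {m} π av₁ av₂ c i<j j<k k<l l<m ki il lj
  with l , refl ← finite l<m
  with k , refl ← finite (<-trans k<l l<m)
  with j , refl ← finite (<-trans j<k (<-trans k<l l<m))
  with i , refl ← finite (<-trans i<j (<-trans j<k (<-trans k<l l<m)))
  rewrite word-toℕ π i | word-toℕ π j | word-toℕ π k | word-toℕ π l
  = forbidden c ki il lj
  where
  forbidden : ∀ c → Below c (toℕ (π ⟨$⟩ʳ k)) (toℕ (π ⟨$⟩ʳ i)) →
    Below c (toℕ (π ⟨$⟩ʳ i)) (toℕ (π ⟨$⟩ʳ l)) → ¬ Below c (toℕ (π ⟨$⟩ʳ l)) (toℕ (π ⟨$⟩ʳ j))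
  -- In order of increasing value, the positions of an occurrence of 2413 are `k`, `i`, `l`, `j`;
  -- those of 3142, in the next clause, are `j`, `l`, `i`, `k`.
  forbidden true ki il lj = av₁ (contains p2413 π (i ∷ j ∷ k ∷ l ∷ []) (Vec.map (π ⟨$⟩ʳ_) (k ∷ i ∷ l ∷ j ∷ []))
    (lookup (1F ∷ 3F ∷ 0F ∷ 2F ∷ []))
    (λ { 0F → refl ; 1F → refl ; 2F → refl ; 3F → refl })
    (λ { 0F → refl ; 1F → refl ; 2F → refl ; 3F → refl })
    (increasing i<j j<k k<l) (increasing ki il lj))
  forbidden false ik li jl = av₂ (contains p3142 π (i ∷ j ∷ k ∷ l ∷ []) (Vec.map (π ⟨$⟩ʳ_) (j ∷ l ∷ i ∷ k ∷ []))
    (lookup (2F ∷ 0F ∷ 3F ∷ 1F ∷ []))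
    (λ { 0F → refl ; 1F → refl ; 2F → refl ; 3F → refl })
    (λ { 0F → refl ; 1F → refl ; 2F → refl ; 3F → refl })
    (increasing i<j j<k k<l) (increasing jl li ik))

separable⇒avoids : (π : Permutation′ m) → SeparableBelow m (word π) → Avoids p2413 π × Avoids p3142 π
separable⇒avoids {m} π sep =
  (λ { (i ∷ j ∷ k ∷ l ∷ [] , inc , val) → forbid true i j k l
       (inc 0F 1F ≤-refl) (inc 1F 2F ≤-refl) (inc 2F 3F ≤-refl)
       (proj₁ (val 2F 0F) ≤-refl) (proj₁ (val 0F 3F) ≤-refl) (proj₁ (val 3F 1F) ≤-refl) }) ,
  (λ { (i ∷ j ∷ k ∷ l ∷ [] , inc , val) → forbid false i j k l
       (inc 0F 1F ≤-refl) (inc 1F 2F ≤-refl) (inc 2F 3F ≤-refl)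
       (proj₁ (val 0F 2F) ≤-refl) (proj₁ (val 3F 0F) ≤-refl) (proj₁ (val 1F 3F) ≤-refl) })
  where
  forbid : ∀ c (i j k l : Fin m) → i Fin.< j → j Fin.< k → k Fin.< l →
    Below c (toℕ (π ⟨$⟩ʳ k)) (toℕ (π ⟨$⟩ʳ i)) →
    Below c (toℕ (π ⟨$⟩ʳ i)) (toℕ (π ⟨$⟩ʳ l)) → ¬ Below c (toℕ (π ⟨$⟩ʳ l)) (toℕ (π ⟨$⟩ʳ j))
  forbid c i j k l rewrite sym (word-toℕ π i) | sym (word-toℕ π j) | sym (word-toℕ π k) | sym (word-toℕ π l)
    = λ i<j j<k k<l → sep c i<j j<k k<l (toℕ<n l)

𝔄⇒shape : (π : Permutation′ m) → 0 < m → 𝔄 π → ∃ λ t → Good t × Shape (word π) 0 m t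
𝔄⇒shape {m} π 0<m (alt , av₁ , av₂) = shape-exists (word-injective π) (avoids⇒separable π av₁ av₂)
  (alternating⇒ π alt) m 0<m (≤-reflexive (sym (+-identityʳ m))) ≤-refl

shape⇒𝔄 : ∀ {t} (π : Permutation′ m) → Shape (word π) 0 m t → 𝔄 π
shape⇒𝔄 π shape = ⇒alternating π (shape-alternating shape z≤n) ,
  separable⇒avoids π (λ c i<j → shape-separable shape c z≤n i<j)

-- Counting along a correspondence

module _ {A B : Set} (_~_ : A → A → Set) (R : A → B → Set)
  (functional : ∀ {x x′ y} → R x y → R x′ y → x ~ x′) where

  -- Pigeonhole by induction on `xs`: the partner of the first element is removed from `ys`. By
  -- `functional` it is not a partner of any later element, so these keep theirs.
  length-≤ : ∀ {xs ys} → AllPairs (λ x x′ → ¬ x ~ x′) xs → All (λ x → Any (R x) ys) xs →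
    length xs ≤ length ys
  length-≤ [] [] = z≤n
  length-≤ {ys = ys} (px ∷ pxs) (q ∷ qs) = subst (_ ≤_) (sym (length-removeAt′ ys (Any.index q)))
    (s≤s (length-≤ pxs (All.zipWith (λ (x≁x′ , q′) → keep x≁x′ q q′) (px , qs))))
    where
    keep : ∀ {x x′ ys} → ¬ x ~ x′ → (q : Any (R x) ys) → Any (R x′) ys → Any (R x′) (ys ─ q)
    keep x≁x′ (here r)  (here r′)  = contradiction (functional r r′) x≁x′
    keep x≁x′ (here r)  (there q′) = q′
    keep x≁x′ (there q) (here r′)  = here r′
    keep x≁x′ (there q) (there q′) = there (keep x≁x′ q q′)

-- `length-≤` for `R` and for its converse. Distinctness in `xs` is taken up to `_~_` because
-- permutations are listed up to pointwise equality.
length-filter-≡ : {A B : Set} {_~_ : A → A → Set} {P : A → Set} (P? : Decidable P)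
  (R : A → B → Set) → (∀ {x x′ y} → R x y → R x′ y → x ~ x′) → (∀ {x y y′} → R x y → R x y′ → y ≡ y′) →
  (∀ {x y} → R x y → P x) → ∀ xs ys → AllPairs (λ x x′ → ¬ x ~ x′) xs → Unique ys →
  (∀ x → P x → Any (R x) ys) → (∀ y → y ∈ ys → Any (λ x → R x y) xs) →
  length (filter P? xs) ≡ length ys
length-filter-≡ {P = P} P? R functional injective R⇒P xs ys xs! ys! total onto = ≤-antisym
  (length-≤ _ R functional (AllPairs.filter⁺ P? xs!) (All.map (total _) (All.all-filter P? xs)))
  (length-≤ _≡_ (λ y x → R x y) injective ys! (All.tabulate onto′))
  where
  onto′ : ∀ {y} → y ∈ ys → Any (λ x → R x y) (filter P? xs)
  onto′ y∈ys with found ← onto _ y∈ys with Any.filter⁺ P? found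
  ... | inj₁ p = p
  ... | inj₂ ¬p = contradiction (R⇒P (Any.lookup-result found)) ¬p

Evaluates : Permutation′ m → Tree → Set
Evaluates {m} π t = Good t × Shape (word π) 0 m t

∣𝔄∣-trees : ∀ ts → 0 < m → Unique ts → (∀ {t} → t ∈ ts → Good t × size t ≡ m) →
  (∀ {t} → Good t → size t ≡ m → t ∈ ts) → ∣𝔄∣ m ≡ length ts
∣𝔄∣-trees {m} ts 0<m ts! sound complete = length-filter-≡ 𝔄? Evaluates
  (λ {π} {ρ} (_ , p) (_ , q) → shape⇒≈ π ρ p q) (λ (g , p) (g′ , q) → shape-unique g g′ p q)
  (λ {π} (_ , p) → shape⇒𝔄 π p) (perms m) ts (perms-unique m) ts! tree perm
  where
  tree : (π : Permutation′ m) → 𝔄 π → Any (Evaluates π) ts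
  tree π π∈𝔄 with t , good , shape ← 𝔄⇒shape π 0<m π∈𝔄 =
    lose (complete good (shape-size shape)) (good , shape)
  perm : ∀ t → t ∈ ts → Any (λ π → Evaluates π t) (perms m)
  perm t t∈ts with good , refl ← sound t∈ts with π , shape ← realise-permutation t =
    -- The list `perms m` contains the realised permutation only up to `_≈_`, so the shape is
    -- transported along `word-cong`.
    Any.map (λ {ρ} π≈ρ → good , shape-cong (λ _ → word-cong {π = π} {ρ} π≈ρ) shape) (perms-complete π)

-- Enumeration of good trees

∑<-cong : ∀ n {f g : ℕ → ℕ} → (∀ {i} → i < n → f i ≡ g i) → ∑< n f ≡ ∑< n g
∑<-cong n eq = cong sum (map-cong-local (All.tabulate (eq ∘ ∈-upTo⁻)))

nodes : (ℕ → List Tree) → (ℕ → List Tree) → ℕ → ℕ → List Tree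
nodes F G n i = cartesianProductWith node (F i) (G (n ∸ i))

splits : (ℕ → List Tree) → (ℕ → List Tree) → ℕ → List Tree
splits F G n = concatMap (nodes F G n) (upTo (suc n))

module _ (F G : ℕ → List Tree) where

  splits-∈⁺ : ∀ {s t i j} → s ∈ F i → t ∈ G j → node s t ∈ splits F G (i + j)
  splits-∈⁺ {s} {t} {i} {j} s∈ t∈ = ∈-concatMap⁺ (nodes F G (i + j)) (lose (∈-upTo⁺ (s≤s (m≤m+n i j)))
    (∈-cartesianProductWith⁺ node s∈ (subst (λ k → t ∈ G k) (sym (m+n∸m≡n i j)) t∈)))

  nodes-∈⁻ : ∀ {u} n i → u ∈ nodes F G n i → ∃₂ λ s t → s ∈ F i × t ∈ G (n ∸ i) × u ≡ node s t
  nodes-∈⁻ n i = ∈-cartesianProductWith⁻ node (F i) (G (n ∸ i))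

  splits-∈⁻ : ∀ {u} n → u ∈ splits F G n →
    ∃₂ λ i j → i + j ≡ n × ∃₂ λ s t → s ∈ F i × t ∈ G j × u ≡ node s t
  splits-∈⁻ n u∈ with i , i∈ , u∈i ← find (∈-concatMap⁻ (nodes F G n) {xs = upTo (suc n)} u∈) =
    i , n ∸ i , m+[n∸m]≡n (s≤s⁻¹ (∈-upTo⁻ i∈)) , nodes-∈⁻ n i u∈i

  -- The size of the left subtree recovers `i`, so different indices contribute disjoint lists.
  splits-unique : (∀ i → Unique (F i)) → (∀ j → Unique (G j)) →
    (∀ {s i} → s ∈ F i → size s ≡ i) → ∀ n → Unique (splits F G n)
  splits-unique F! G! sizes n = Unique.concat⁺
    (All.map⁺ (All.tabulate λ {i} _ → Unique.cartesianProductWith⁺ node (λ { refl → refl , refl }) (F! i) (G! (n ∸ i))))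
    (AllPairs.map⁺ (AllPairs.map disjoint (Unique.upTo⁺ (suc n))))
    where
    disjoint : ∀ {i i′} → i ≢ i′ → ∀ {u} → ¬ (u ∈ nodes F G n i × u ∈ nodes F G n i′)
    disjoint {i} {i′} i≢i′ (u∈i , u∈i′)
      with _ , _ , s∈ , _ , refl ← nodes-∈⁻ n i u∈i | _ , _ , s∈′ , _ , refl ← nodes-∈⁻ n i′ u∈i′ =
      i≢i′ (trans (sym (sizes s∈)) (sizes s∈′))

  length-splits : ∀ n → length (splits F G n) ≡ ∑< (suc n) λ i → length (F i) * length (G (n ∸ i))
  length-splits n = trans (length-concatMap (upTo (suc n))) (∑<-cong (suc n) λ {i} _ → length-product (F i) (G (n ∸ i)))
    where
    length-concatMap : ∀ is → length (concatMap (nodes F G n) is) ≡ sum (map (length ∘ nodes F G n) is)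
    length-concatMap []       = refl
    length-concatMap (i ∷ is) = trans (length-++ (nodes F G n i)) (cong (length (nodes F G n i) +_) (length-concatMap is))
    length-product : ∀ ss ts → length (cartesianProductWith node ss ts) ≡ length ss * length ts
    length-product []       ts = refl
    length-product (s ∷ ss) ts = trans (length-++ (map (node s) ts)) (cong₂ _+_ (length-map (node s) ts) (length-product ss ts))

OddIf : Bool → ℕ → Set
OddIf true  n = odd n ≡ true
OddIf false n = ⊤

restrict : Bool → (ℕ → List Tree) → ℕ → List Tree
restrict true  F n = if odd n then F n else []
restrict false F n = F n

restrict-∈⁺ : ∀ o {F t n} → OddIf o n → t ∈ F n → t ∈ restrict o F n
restrict-∈⁺ true  e t∈ rewrite e = t∈
restrict-∈⁺ false _ t∈ = t∈

restrict-∈⁻ : ∀ o {F t} n → t ∈ restrict o F n → OddIf o n × t ∈ F n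
restrict-∈⁻ true  n t∈ with odd n in e
... | true = refl , t∈
restrict-∈⁻ false n t∈ = tt , t∈

restrict-unique : ∀ o {F n} → Unique (F n) → Unique (restrict o F n)
restrict-unique true  {n = n} F! with odd n
... | true  = F!
... | false = []
restrict-unique false F! = F!

leaves : ℕ → List Tree
leaves 1 = leaf ∷ []
leaves _ = []

-- trees true lists the trees that may be left subtrees of good trees.  The
-- second argument bounds the depth of the recursion.
trees : Bool → ℕ → ℕ → List Tree
trees o zero    n = []
trees o (suc d) n = leaves n ++ splits (trees true d) (restrict o (trees false d)) n

RightOddIf : Bool → Tree → Set
RightOddIf true  t = RightOdd t
RightOddIf false t = ⊤

trees-sound : ∀ o d {n t} → t ∈ trees o d n → Good t × RightOddIf o t × size t ≡ n
trees-sound o (suc d) {n} t∈ with ∈-++⁻ (leaves n) t∈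
... | inj₁ t∈leaves = base o n t∈leaves
  where
  base : ∀ o n {t} → t ∈ leaves n → Good t × RightOddIf o t × size t ≡ n
  base true  1 (here refl) = tt , tt , refl
  base false 1 (here refl) = tt , tt , refl
... | inj₂ t∈splits
  with i , j , refl , s , t , s∈ , t∈ , refl ← splits-∈⁻ (trees true d) (restrict o (trees false d)) n t∈splits
  with good-s , rodd-s , refl ← trees-sound true d s∈
  with odd-j , t∈ ← restrict-∈⁻ o {trees false d} j t∈
  with good-t , _ , refl ← trees-sound false d t∈ = (good-s , rodd-s , good-t) , right o odd-j , refl
  where
  right : ∀ o → OddIf o (size t) → RightOddIf o (node s t)
  right true  e = e
  right false _ = tt

size-positive : ∀ t → 0 < size t
size-positive leaf       = s≤s z≤n
size-positive (node s t) = ≤-trans (size-positive s) (m≤m+n (size s) (size t))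

trees-complete : ∀ o d t → Good t → RightOddIf o t → size t ≤ d → t ∈ trees o d (size t)
trees-complete o zero    t          _ _ t≤d = contradiction (size-positive t) (≤⇒≯ t≤d)
trees-complete o (suc d) leaf       _ _ _   = here refl
trees-complete o (suc d) (node s t) (good-s , rodd-s , good-t) rodd t≤d =
  ∈-++⁺ʳ (leaves (size s + size t)) (splits-∈⁺ (trees true d) (restrict o (trees false d))
    (trees-complete true d s good-s rodd-s (s≤s⁻¹ (≤-trans
      (≤-trans (≤-reflexive (+-comm 1 (size s))) (+-monoʳ-≤ (size s) (size-positive t))) t≤d)))
    (restrict-∈⁺ o {trees false d} (right o rodd) (trees-complete false d t good-t tt (s≤s⁻¹ (≤-trans
      (+-monoˡ-≤ (size t) (size-positive s)) t≤d)))))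
  where
  right : ∀ o → RightOddIf o (node s t) → OddIf o (size t)
  right true  e = e
  right false _ = tt

trees-unique : ∀ o d n → Unique (trees o d n)
trees-unique o zero    n = []
trees-unique o (suc d) n = Unique.++⁺ (leaves-unique n)
  (splits-unique (trees true d) (restrict o (trees false d)) (trees-unique true d)
    (λ j → restrict-unique o {trees false d} (trees-unique false d j))
    (λ s∈ → proj₂ (proj₂ (trees-sound true d s∈))) n)
  (λ (t∈leaves , t∈splits) → disjoint n t∈leaves t∈splits)
  where
  leaves-unique : ∀ n → Unique (leaves n)
  leaves-unique 0             = []
  leaves-unique 1             = [] ∷ []
  leaves-unique (suc (suc _)) = []
  disjoint : ∀ n {t} → t ∈ leaves n → ¬ t ∈ splits (trees true d) (restrict o (trees false d)) n
  disjoint 1 (here refl) t∈ with splits-∈⁻ (trees true d) (restrict o (trees false d)) 1 t∈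
  ... | _ , _ , _ , _ , _ , _ , _ , ()

-- `count false` is the series of all good trees, `count true` that of the possible left subtrees;
-- depth `n` suffices for trees with `n` leaves.
count : Bool → ℕ → ℕ
count o n = length (trees o n n)

-- The two lists are not compared entry by entry: both are free of repetitions, and soundness and
-- completeness place every tree of one in the other, so `length-≤` applies both ways.
length-trees : ∀ o {d n} → n ≤ d → length (trees o d n) ≡ count o n
length-trees o {d} {n} n≤d = ≤-antisym (bound d n ≤-refl) (bound n d n≤d)
  where
  bound : ∀ d d′ → n ≤ d′ → length (trees o d n) ≤ length (trees o d′ n)
  bound d d′ n≤d′ = length-≤ _≡_ _≡_ (λ p q → trans p (sym q)) (trees-unique o d n)
    (All.tabulate λ {t} t∈ → transfer t (trees-sound o d t∈))
    where
    transfer : ∀ t → Good t × RightOddIf o t × size t ≡ n → t ∈ trees o d′ n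
    transfer t (good , rodd , refl) = trees-complete o d′ t good rodd n≤d′

oddPart : Series → Series
oddPart f n = if odd n then f n else 0

length-leaves : ∀ n → length (leaves n) ≡ x n
length-leaves 0             = refl
length-leaves 1             = refl
length-leaves (suc (suc n)) = refl

-- Unfolding at depth `suc n` leaves depth `n` for the subtrees, which is enough because their sizes
-- are at most `n`.
count-recurrence : ∀ o (g : Series) →
  (∀ {n j} → j ≤ n → length (restrict o (trees false n) j) ≡ g j) → count o ≗ x ⊕ count true ⊛ g
count-recurrence o g eq n = trans (sym (length-trees o (n≤1+n n))) (trans (length-++ (leaves n))
  (cong₂ _+_ (length-leaves n) (trans (length-splits (trees true n) (restrict o (trees false n)) n)
    (∑<-cong (suc n) λ {i} i<n → cong₂ _*_ (length-trees true (s≤s⁻¹ i<n)) (eq (m∸n≤m n i))))))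

count-open : count true ≗ x ⊕ count true ⊛ oddPart (count false)
count-open = count-recurrence true (oddPart (count false)) eq
  where
  eq : ∀ {n j} → j ≤ n → length (restrict true (trees false n) j) ≡ oddPart (count false) j
  eq {j = j} j≤n with odd j
  ... | true  = length-trees false j≤n
  ... | false = refl

count-all : count false ≗ x ⊕ count true ⊛ count false
count-all = count-recurrence false (count false) (length-trees false)

∑<-suc : ∀ n f → ∑< (suc n) f ≡ f 0 + ∑< n (f ∘ suc)
∑<-suc n f = cong (λ is → f 0 + sum is)
  (trans (map-applyUpTo suc f n) (sym (map-upTo (f ∘ suc) n)))

∑<-+ : ∀ n f g → ∑< n (λ i → f i + g i) ≡ ∑< n f + ∑< n g
∑<-+ zero    f g = refl
∑<-+ (suc n) f g rewrite ∑<-suc n (λ i → f i + g i) | ∑<-suc n f | ∑<-suc n g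
  | ∑<-+ n (f ∘ suc) (g ∘ suc) = interchange (f 0) (g 0) _ _
  where
  interchange : ∀ a b c d → (a + b) + (c + d) ≡ (a + c) + (b + d)
  interchange = solve-∀

∑<-* : ∀ n c f → ∑< n (λ i → c * f i) ≡ c * ∑< n f
∑<-* zero    c f = sym (*-zeroʳ c)
∑<-* (suc n) c f rewrite ∑<-suc n (λ i → c * f i) | ∑<-suc n f | ∑<-* n c (f ∘ suc) =
  sym (*-distribˡ-+ c (f 0) _)

-- The commutative semiring of series

tail : Series → Series
tail f n = f (suc n)

infixr 7 _·_

_·_ : ℕ → Series → Series
(c · f) n = c * f n

𝟘 : Series
𝟘 _ = 0

⊛-zero : ∀ f g → (f ⊛ g) 0 ≡ f 0 * g 0
⊛-zero f g = +-identityʳ (f 0 * g 0)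

⊛-suc : ∀ f g n → (f ⊛ g) (suc n) ≡ f 0 * g (suc n) + (tail f ⊛ g) n
⊛-suc f g n = ∑<-suc (suc n) (λ i → f i * g (suc n ∸ i))

⊛-cong : ∀ {f f′ g g′} → f ≗ f′ → g ≗ g′ → f ⊛ g ≗ f′ ⊛ g′
⊛-cong p q n = ∑<-cong (suc n) λ {i} _ → cong₂ _*_ (p i) (q (n ∸ i))

⊛-congʳ : ∀ {f f′} g → f ≗ f′ → f ⊛ g ≗ f′ ⊛ g
⊛-congʳ g p = ⊛-cong {g = g} p λ _ → refl

-- The mirror image of `⊛-suc`; the two together give commutativity by induction, without reindexing
-- a sum.
⊛-sucʳ : ∀ f g n → (f ⊛ g) (suc n) ≡ f (suc n) * g 0 + (f ⊛ tail g) n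
⊛-sucʳ f g zero
  rewrite ⊛-suc f g 0 | ⊛-zero (tail f) g | ⊛-zero f (tail g) = +-comm (f 0 * g 1) (f 1 * g 0)
⊛-sucʳ f g (suc n)
  rewrite ⊛-suc f g (suc n) | ⊛-sucʳ (tail f) g n | ⊛-suc f (tail g) n =
  swap (f 0 * g (suc (suc n))) (f (suc (suc n)) * g 0) ((tail f ⊛ tail g) n)
  where
  swap : ∀ a b c → a + (b + c) ≡ b + (a + c)
  swap = solve-∀

⊛-comm : ∀ f g → f ⊛ g ≗ g ⊛ f
⊛-comm f g zero rewrite ⊛-zero f g | ⊛-zero g f = *-comm (f 0) (g 0)
⊛-comm f g (suc n) rewrite ⊛-suc f g n | ⊛-sucʳ g f n =
  cong₂ _+_ (*-comm (f 0) (g (suc n))) (⊛-comm (tail f) g n)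

⊛-distribʳ-⊕ : ∀ h f g → (f ⊕ g) ⊛ h ≗ f ⊛ h ⊕ g ⊛ h
⊛-distribʳ-⊕ h f g n = trans
  (∑<-cong (suc n) λ {i} _ → *-distribʳ-+ (h (n ∸ i)) (f i) (g i)) (∑<-+ (suc n) (λ i → f i * h (n ∸ i)) (λ i → g i * h (n ∸ i)))

·-⊛-assoc : ∀ c f g → (c · f) ⊛ g ≗ c · (f ⊛ g)
·-⊛-assoc c f g n = trans (∑<-cong (suc n) λ {i} _ → *-assoc c (f i) (g (n ∸ i))) (∑<-* (suc n) c (λ i → f i * g (n ∸ i)))

-- The tail of `f ⊛ g` is `f 0 · tail g ⊕ tail f ⊛ g`, which reduces the coefficient at `suc n` to
-- associativity for `tail f` at `n`.
⊛-assoc : ∀ f g h → (f ⊛ g) ⊛ h ≗ f ⊛ (g ⊛ h)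
⊛-assoc f g h zero
  rewrite ⊛-zero (f ⊛ g) h | ⊛-zero f g | ⊛-zero f (g ⊛ h) | ⊛-zero g h = *-assoc (f 0) (g 0) (h 0)
⊛-assoc f g h (suc n) = begin
  ((f ⊛ g) ⊛ h) (suc n)
    ≡⟨ ⊛-suc (f ⊛ g) h n ⟩
  (f ⊛ g) 0 * h (suc n) + (tail (f ⊛ g) ⊛ h) n
    ≡⟨ cong₂ _+_ (cong (_* h (suc n)) (⊛-zero f g)) (⊛-congʳ h (⊛-suc f g) n) ⟩
  f 0 * g 0 * h (suc n) + ((f 0 · tail g ⊕ tail f ⊛ g) ⊛ h) n
    ≡⟨ cong (f 0 * g 0 * h (suc n) +_) (⊛-distribʳ-⊕ h (f 0 · tail g) (tail f ⊛ g) n) ⟩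
  f 0 * g 0 * h (suc n) + (((f 0 · tail g) ⊛ h) n + ((tail f ⊛ g) ⊛ h) n)
    ≡⟨ cong (f 0 * g 0 * h (suc n) +_) (cong₂ _+_ (·-⊛-assoc (f 0) (tail g) h n) (⊛-assoc (tail f) g h n)) ⟩
  f 0 * g 0 * h (suc n) + (f 0 * (tail g ⊛ h) n + (tail f ⊛ (g ⊛ h)) n)
    ≡⟨ regroup (f 0) (g 0) (h (suc n)) _ _ ⟩
  f 0 * (g 0 * h (suc n) + (tail g ⊛ h) n) + (tail f ⊛ (g ⊛ h)) n
    ≡⟨ cong (λ c → f 0 * c + (tail f ⊛ (g ⊛ h)) n) (⊛-suc g h n) ⟨
  f 0 * (g ⊛ h) (suc n) + (tail f ⊛ (g ⊛ h)) n
    ≡⟨ ⊛-suc f (g ⊛ h) n ⟨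
  (f ⊛ (g ⊛ h)) (suc n) ∎
  where
  open ≡-Reasoning
  regroup : ∀ a b c d e → a * b * c + (a * d + e) ≡ a * (b * c + d) + e
  regroup = solve-∀

⊛-zeroˡ : ∀ f → 𝟘 ⊛ f ≗ 𝟘
⊛-zeroˡ f n = trans (∑<-cong (suc n) {g = λ _ → 0 * 0} λ _ → refl) (∑<-* (suc n) 0 (λ _ → 0))

⊛-identityˡ : ∀ f → 𝟙 ⊛ f ≗ f
⊛-identityˡ f zero    = trans (⊛-zero 𝟙 f) (*-identityˡ (f 0))
⊛-identityˡ f (suc n) = trans (⊛-suc 𝟙 f n)
  (trans (cong₂ _+_ (*-identityˡ (f (suc n))) (⊛-zeroˡ f n)) (+-identityʳ _))

series : CommutativeSemiring 0ℓ 0ℓ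
series = record
  { Carrier = Series
  ; _≈_ = _≗_
  ; _+_ = _⊕_
  ; _*_ = _⊛_
  ; 0# = 𝟘
  ; 1# = 𝟙
  ; isCommutativeSemiring = isCommutativeSemiringˡ record
    { +-isCommutativeMonoid = record
      { isMonoid = record
        { isSemigroup = record
          { isMagma = record
            { isEquivalence = isEquivalence
            ; ∙-cong = λ p q n → cong₂ _+_ (p n) (q n)
            }
          ; assoc = λ f g h n → +-assoc (f n) (g n) (h n)
          }
        ; identity = (λ _ _ → refl) , λ f n → +-identityʳ (f n)
        }
      ; comm = λ f g n → +-comm (f n) (g n)
      }
    ; *-isCommutativeMonoid = record
      { isMonoid = record
        { isSemigroup = record
          { isMagma = record { isEquivalence = isEquivalence ; ∙-cong = ⊛-cong }
          ; assoc = ⊛-assoc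
          }
        ; identity = ⊛-identityˡ , λ f n → trans (⊛-comm f 𝟙 n) (⊛-identityˡ f n)
        }
      ; comm = ⊛-comm
      }
    ; distribʳ = ⊛-distribʳ-⊕
    ; zeroˡ = ⊛-zeroˡ
    }
  }
  where open Setoid (ℕ →-setoid ℕ) using (isEquivalence)

x⊛-zero : ∀ f → (x ⊛ f) 0 ≡ 0
x⊛-zero f = ⊛-zero x f

x⊛-suc : ∀ f n → (x ⊛ f) (suc n) ≡ f n
x⊛-suc f n = trans (⊛-suc x f n) (trans (⊛-congʳ f tail-x n) (⊛-identityˡ f n))
  where
  tail-x : tail x ≗ 𝟙
  tail-x zero    = refl
  tail-x (suc n) = refl

-- Even and odd parts

evens odds : Series → Series
evens f n = f (2 * n)
odds  f n = f (suc (2 * n))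

evens-tail : ∀ f → evens (tail (tail f)) ≗ tail (evens f)
evens-tail f n = cong f (sym (2*suc n))

odds-tail : ∀ f → odds (tail (tail f)) ≗ tail (odds f)
odds-tail f n = cong (f ∘ suc) (sym (2*suc n))

-- An odd exponent is even plus odd or odd plus even. The induction strips two coefficients of `f`
-- at a time, one for each summand.
odds-⊛ : ∀ f g → odds (f ⊛ g) ≗ evens f ⊛ odds g ⊕ odds f ⊛ evens g
odds-⊛ f g zero
  rewrite ⊛-suc f g 0 | ⊛-zero (tail f) g | ⊛-zero (evens f) (odds g) = refl
odds-⊛ f g (suc n) = begin
  (f ⊛ g) (suc (2 * suc n))
    ≡⟨ ⊛-suc f g (2 * suc n) ⟩
  f 0 * odds g (suc n) + (tail f ⊛ g) (2 * suc n)
    ≡⟨ cong (λ m → f 0 * odds g (suc n) + (tail f ⊛ g) m) (2*suc n) ⟩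
  f 0 * odds g (suc n) + (tail f ⊛ g) (suc (suc (2 * n)))
    ≡⟨ cong (f 0 * odds g (suc n) +_) (⊛-suc (tail f) g (suc (2 * n))) ⟩
  f 0 * odds g (suc n) + (f 1 * g (suc (suc (2 * n))) + odds (tail (tail f) ⊛ g) n)
    ≡⟨ cong₂ (λ u v → f 0 * odds g (suc n) + (f 1 * u + v)) (cong g (sym (2*suc n))) (odds-⊛ (tail (tail f)) g n) ⟩
  f 0 * odds g (suc n) + (f 1 * evens g (suc n) +
    ((evens (tail (tail f)) ⊛ odds g) n + (odds (tail (tail f)) ⊛ evens g) n))
    ≡⟨ cong₂ (λ u v → f 0 * odds g (suc n) + (f 1 * evens g (suc n) + (u + v)))
         (⊛-congʳ (odds g) (evens-tail f) n) (⊛-congʳ (evens g) (odds-tail f) n) ⟩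
  f 0 * odds g (suc n) + (f 1 * evens g (suc n) +
    ((tail (evens f) ⊛ odds g) n + (tail (odds f) ⊛ evens g) n))
    ≡⟨ regroup (f 0 * odds g (suc n)) (f 1 * evens g (suc n)) _ _ ⟩
  (f 0 * odds g (suc n) + (tail (evens f) ⊛ odds g) n) +
    (f 1 * evens g (suc n) + (tail (odds f) ⊛ evens g) n)
    ≡⟨ cong₂ _+_ (⊛-suc (evens f) (odds g) n) (⊛-suc (odds f) (evens g) n) ⟨
  (evens f ⊛ odds g ⊕ odds f ⊛ evens g) (suc n) ∎
  where
  open ≡-Reasoning
  regroup : ∀ a b c d → a + (b + (c + d)) ≡ (a + c) + (b + d)
  regroup = solve-∀

-- The exponents `2i + 1` and `2j + 1` add up to `2(i + j + 1)`, whence the factor `x`.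
evens-⊛ : ∀ f g → evens (f ⊛ g) ≗ evens f ⊛ evens g ⊕ x ⊛ (odds f ⊛ odds g)
evens-⊛ f g zero
  rewrite ⊛-zero f g | ⊛-zero (evens f) (evens g) | x⊛-zero (odds f ⊛ odds g) = refl
evens-⊛ f g (suc n) = begin
  (f ⊛ g) (2 * suc n)
    ≡⟨ cong (f ⊛ g) (2*suc n) ⟩
  (f ⊛ g) (suc (suc (2 * n)))
    ≡⟨ ⊛-suc f g (suc (2 * n)) ⟩
  f 0 * g (suc (suc (2 * n))) + odds (tail f ⊛ g) n
    ≡⟨ cong₂ (λ m v → f 0 * g m + v) (sym (2*suc n)) (odds-⊛ (tail f) g n) ⟩
  f 0 * evens g (suc n) + ((odds f ⊛ odds g) n + (odds (tail f) ⊛ evens g) n)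
    ≡⟨ cong (λ v → f 0 * evens g (suc n) + ((odds f ⊛ odds g) n + v)) (⊛-congʳ (evens g) (evens-tail f) n) ⟩
  f 0 * evens g (suc n) + ((odds f ⊛ odds g) n + (tail (evens f) ⊛ evens g) n)
    ≡⟨ regroup (f 0 * evens g (suc n)) _ _ ⟩
  (f 0 * evens g (suc n) + (tail (evens f) ⊛ evens g) n) + (odds f ⊛ odds g) n
    ≡⟨ cong₂ _+_ (⊛-suc (evens f) (evens g) n) (x⊛-suc (odds f ⊛ odds g) n) ⟨
  (evens f ⊛ evens g ⊕ x ⊛ (odds f ⊛ odds g)) (suc n) ∎
  where
  open ≡-Reasoning
  regroup : ∀ a b c → a + (b + c) ≡ (a + c) + b
  regroup = solve-∀

evens-oddPart : ∀ f → evens (oddPart f) ≗ 𝟘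
evens-oddPart f n rewrite odd-2* n = refl

odds-oddPart : ∀ f → odds (oddPart f) ≗ odds f
odds-oddPart f n rewrite odd-2* n = refl

evens-x : evens x ≗ 𝟘
evens-x zero    = refl
evens-x (suc n) = cong x (2*suc n)

odds-x : odds x ≗ 𝟙
odds-x zero    = refl
odds-x (suc n) = cong (x ∘ suc) (2*suc n)

-- The equation for trees with an odd number of leaves

module S = CommutativeSemiring series

module _ where
  open SetoidReasoning S.setoid
  open SeriesSolver series using (solve; _:+_; _:*_; _:=_)

  oddTrees : Series
  oddTrees = odds (count false)

  oddTrees-equation : let Q = x ⊛ oddTrees ⊛ oddTrees in oddTrees ≗ 𝟙 ⊕ (Q ⊕ Q ⊛ oddTrees)
  oddTrees-equation = begin
    O                      ≈⟨ O-eq′ ⟩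
    𝟙 ⊕ (M ⊛ O ⊕ M ⊛ O)    ≈⟨ S.+-congˡ {𝟙} MO+MO ⟩
    𝟙 ⊕ (Q ⊕ Q ⊛ O)        ∎
    where
    -- Here exponents are halved: `N` and `M` are the odd and even parts of `count true`, `O` and
    -- `E` those of `count false`. The relation E = O² between the unhalved parts thus reads
    -- `E ≗ Q`.
    N M O E Q : Series
    N = odds (count true)
    M = evens (count true)
    O = oddTrees
    E = evens (count false)
    Q = x ⊛ O ⊛ O

    M-eq : M ≗ x ⊛ (N ⊛ O)
    M-eq = begin
      M
        ≈⟨ (λ n → count-open (2 * n)) ⟩
      evens x ⊕ evens (count true ⊛ oddPart (count false))
        ≈⟨ S.+-cong evens-x (evens-⊛ (count true) (oddPart (count false))) ⟩
      𝟘 ⊕ (M ⊛ evens (oddPart (count false)) ⊕ x ⊛ (N ⊛ odds (oddPart (count false))))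
        ≈⟨ S.+-identityˡ _ ⟩
      M ⊛ evens (oddPart (count false)) ⊕ x ⊛ (N ⊛ odds (oddPart (count false)))
        ≈⟨ S.+-cong (S.trans (S.*-congˡ {M} (evens-oddPart (count false))) (S.zeroʳ M))
                  (S.*-congˡ {x} (S.*-congˡ {N} (odds-oddPart (count false)))) ⟩
      𝟘 ⊕ x ⊛ (N ⊛ O)
        ≈⟨ S.+-identityˡ _ ⟩
      x ⊛ (N ⊛ O) ∎

    N-eq : N ≗ 𝟙 ⊕ M ⊛ O
    N-eq = begin
      N
        ≈⟨ (λ n → count-open (suc (2 * n))) ⟩
      odds x ⊕ odds (count true ⊛ oddPart (count false))
        ≈⟨ S.+-cong odds-x (odds-⊛ (count true) (oddPart (count false))) ⟩
      𝟙 ⊕ (M ⊛ odds (oddPart (count false)) ⊕ N ⊛ evens (oddPart (count false)))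
        ≈⟨ S.+-congˡ {𝟙} (S.+-cong (S.*-congˡ {M} (odds-oddPart (count false)))
             (S.trans (S.*-congˡ {N} (evens-oddPart (count false))) (S.zeroʳ N))) ⟩
      𝟙 ⊕ (M ⊛ O ⊕ 𝟘)
        ≈⟨ S.+-congˡ {𝟙} (S.+-identityʳ _) ⟩
      𝟙 ⊕ M ⊛ O ∎

    E-eq : E ≗ M ⊛ E ⊕ x ⊛ (N ⊛ O)
    E-eq = begin
      E
        ≈⟨ (λ n → count-all (2 * n)) ⟩
      evens x ⊕ evens (count true ⊛ count false)
        ≈⟨ S.+-cong evens-x (evens-⊛ (count true) (count false)) ⟩
      𝟘 ⊕ (M ⊛ E ⊕ x ⊛ (N ⊛ O))
        ≈⟨ S.+-identityˡ _ ⟩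
      M ⊛ E ⊕ x ⊛ (N ⊛ O) ∎

    O-eq : O ≗ 𝟙 ⊕ (M ⊛ O ⊕ N ⊛ E)
    O-eq = S.trans (λ n → count-all (suc (2 * n))) (S.+-cong odds-x (odds-⊛ (count true) (count false)))

    M-eq′ : M ≗ x ⊛ O ⊛ 𝟙 ⊕ x ⊛ O ⊛ (M ⊛ O)
    M-eq′ = begin
      M                                  ≈⟨ M-eq ⟩
      x ⊛ (N ⊛ O)                        ≈⟨ S.*-congˡ {x} (S.*-congʳ {O} N-eq) ⟩
      x ⊛ ((𝟙 ⊕ M ⊛ O) ⊛ O)              ≈⟨ solve 4 (λ x e M O →
        x :* ((e :+ M :* O) :* O) := x :* O :* e :+ x :* O :* (M :* O)) S.refl x 𝟙 M O ⟩
      x ⊛ O ⊛ 𝟙 ⊕ x ⊛ O ⊛ (M ⊛ O)        ∎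

    -- A semiring does not allow solving `E-eq` for `E`. Instead one factor `O` of `Q` is expanded
    -- by `O-eq`; the result collects to `M ⊛ E ⊕ M`, which is `E`.
    Q≗E : Q ≗ E
    Q≗E = begin
      x ⊛ O ⊛ O                                     ≈⟨ S.*-congˡ {x ⊛ O} O-eq ⟩
      x ⊛ O ⊛ (𝟙 ⊕ (M ⊛ O ⊕ N ⊛ E))                 ≈⟨ solve 6 (λ x e M N O E →
        x :* O :* (e :+ (M :* O :+ N :* E)) :=
        x :* (N :* O) :* E :+ (x :* O :* e :+ x :* O :* (M :* O))) S.refl x 𝟙 M N O E ⟩
      x ⊛ (N ⊛ O) ⊛ E ⊕ (x ⊛ O ⊛ 𝟙 ⊕ x ⊛ O ⊛ (M ⊛ O)) ≈⟨ S.+-cong (S.*-congʳ {E} M-eq) M-eq′ ⟨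
      M ⊛ E ⊕ M                                     ≈⟨ S.+-congˡ {M ⊛ E} M-eq ⟩
      M ⊛ E ⊕ x ⊛ (N ⊛ O)                           ≈⟨ E-eq ⟨
      E                                             ∎

    MO : M ⊛ O ≗ Q ⊛ 𝟙 ⊕ Q ⊛ (M ⊛ O)
    MO = begin
      M ⊛ O                            ≈⟨ S.*-congʳ {O} M-eq ⟩
      x ⊛ (N ⊛ O) ⊛ O                  ≈⟨ solve 3 (λ x N O →
        x :* (N :* O) :* O := x :* O :* O :* N) S.refl x N O ⟩
      Q ⊛ N                            ≈⟨ S.*-congˡ {Q} N-eq ⟩
      Q ⊛ (𝟙 ⊕ M ⊛ O)                  ≈⟨ solve 3 (λ Q e P → Q :* (e :+ P) := Q :* e :+ Q :* P) S.refl Q 𝟙 (M ⊛ O) ⟩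
      Q ⊛ 𝟙 ⊕ Q ⊛ (M ⊛ O)              ∎

    O-eq′ : O ≗ 𝟙 ⊕ (M ⊛ O ⊕ M ⊛ O)
    O-eq′ = begin
      O                             ≈⟨ O-eq ⟩
      𝟙 ⊕ (M ⊛ O ⊕ N ⊛ E)           ≈⟨ S.+-congˡ {𝟙} (S.+-congˡ {M ⊛ O} NE) ⟩
      𝟙 ⊕ (M ⊛ O ⊕ M ⊛ O)           ∎
      where
      NE : N ⊛ E ≗ M ⊛ O
      NE = begin
        N ⊛ E              ≈⟨ S.*-congˡ {N} Q≗E ⟨
        N ⊛ Q              ≈⟨ solve 3 (λ x N O → N :* (x :* O :* O) := x :* (N :* O) :* O) S.refl x N O ⟩
        x ⊛ (N ⊛ O) ⊛ O    ≈⟨ S.*-congʳ {O} M-eq ⟨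
        M ⊛ O              ∎

    -- After both copies are expanded by `MO`, one `Q ⊛ 𝟙` is set aside, and the rest is `Q` times
    -- the right-hand side of `O-eq′`.
    MO+MO : M ⊛ O ⊕ M ⊛ O ≗ Q ⊕ Q ⊛ O
    MO+MO = begin
      M ⊛ O ⊕ M ⊛ O                                       ≈⟨ S.+-cong MO MO ⟩
      Q ⊛ 𝟙 ⊕ Q ⊛ (M ⊛ O) ⊕ (Q ⊛ 𝟙 ⊕ Q ⊛ (M ⊛ O))         ≈⟨ solve 3 (λ Q e P →
        Q :* e :+ Q :* P :+ (Q :* e :+ Q :* P) := Q :* e :+ Q :* (e :+ (P :+ P))) S.refl Q 𝟙 (M ⊛ O) ⟩
      Q ⊛ 𝟙 ⊕ Q ⊛ (𝟙 ⊕ (M ⊛ O ⊕ M ⊛ O))                   ≈⟨ S.+-cong (S.*-identityʳ Q) (S.*-congˡ {Q} (S.sym O-eq′)) ⟩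
      Q ⊕ Q ⊛ O                                           ∎

-- Lagrange inversion

-- The operator x d/dx.
D : Series → Series
D f n = n * f n

⊛-· : ∀ f c g → f ⊛ (c · g) ≗ c · (f ⊛ g)
⊛-· f c g n = trans (⊛-comm f (c · g) n)
  (trans (·-⊛-assoc c g f n) (cong (c *_) (⊛-comm g f n)))

D-⊛ : ∀ f g → D (f ⊛ g) ≗ D f ⊛ g ⊕ f ⊛ D g
D-⊛ f g n = trans (sym (∑<-* (suc n) n (λ i → f i * g (n ∸ i)))) (trans
  (∑<-cong (suc n) λ {i} i≤n → trans (cong (_* (f i * g (n ∸ i))) (sym (m+[n∸m]≡n (s≤s⁻¹ i≤n))))
    (leibniz i (n ∸ i) (f i) (g (n ∸ i))))
  (∑<-+ (suc n) (λ i → D f i * g (n ∸ i)) (λ i → f i * D g (n ∸ i))))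
  where
  leibniz : ∀ i j u v → (i + j) * (u * v) ≡ i * u * v + u * (j * v)
  leibniz = solve-∀

D-⊛^ : ∀ f m → D (f ⊛^ suc m) ≗ suc m · (D f ⊛ f ⊛^ m)
D-⊛^ f zero n = begin
  D (f ⊛ 𝟙) n                     ≡⟨ D-⊛ f 𝟙 n ⟩
  (D f ⊛ 𝟙) n + (f ⊛ D 𝟙) n       ≡⟨ cong (λ c → (D f ⊛ 𝟙) n + c)
    (trans (⊛-comm f (D 𝟙) n) (trans (⊛-congʳ f D𝟙 n) (⊛-zeroˡ f n))) ⟩
  (D f ⊛ 𝟙) n + 0                 ∎
  where
  open ≡-Reasoning
  D𝟙 : D 𝟙 ≗ 𝟘
  D𝟙 zero    = refl
  D𝟙 (suc n) = *-zeroʳ n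
D-⊛^ f (suc m) n = begin
  D (f ⊛ f ⊛^ suc m) n
    ≡⟨ D-⊛ f (f ⊛^ suc m) n ⟩
  (D f ⊛ f ⊛^ suc m) n + (f ⊛ D (f ⊛^ suc m)) n
    ≡⟨ cong ((D f ⊛ f ⊛^ suc m) n +_) step ⟩
  (D f ⊛ f ⊛^ suc m) n + suc m * (D f ⊛ f ⊛^ suc m) n ∎
  where
  open ≡-Reasoning
  open SeriesSolver series using (solve; _:*_; _:=_)
  step : (f ⊛ D (f ⊛^ suc m)) n ≡ suc m * (D f ⊛ f ⊛^ suc m) n
  step = begin
    (f ⊛ D (f ⊛^ suc m)) n                 ≡⟨ S.*-congˡ {f} (D-⊛^ f m) n ⟩
    (f ⊛ (suc m · (D f ⊛ f ⊛^ m))) n       ≡⟨ ⊛-· f (suc m) (D f ⊛ f ⊛^ m) n ⟩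
    suc m * (f ⊛ (D f ⊛ f ⊛^ m)) n         ≡⟨ cong (suc m *_) (solve 3 (λ f g h →
      f :* (g :* h) := g :* (f :* h)) S.refl f (D f) (f ⊛^ m) n) ⟩
    suc m * (D f ⊛ f ⊛^ suc m) n           ∎

-- The coefficient of xʲ in ∑ᵢ φᵢ xⁱ G i.
diagonal : Series → (ℕ → Series) → Series
diagonal φ G j = ∑[ i < suc j ] (φ i * G i (j ∸ i))

diagonal-𝟘 : ∀ G → diagonal 𝟘 G ≗ 𝟘
diagonal-𝟘 G j = ∑<-* (suc j) 0 (λ i → G i (j ∸ i))

diagonal-suc : ∀ φ G → diagonal φ G ≗ φ 0 · G 0 ⊕ x ⊛ diagonal (tail φ) (G ∘ suc)
diagonal-suc φ G zero    = cong (φ 0 * G 0 0 +_) (sym (x⊛-zero (diagonal (tail φ) (G ∘ suc))))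
diagonal-suc φ G (suc j) = trans (∑<-suc (suc j) (λ i → φ i * G i (suc j ∸ i)))
  (cong (φ 0 * G 0 (suc j) +_) (sym (x⊛-suc (diagonal (tail φ) (G ∘ suc)) j)))

-- The hypothesis says that v = φ(x v), multiplied by the powers of v.
lagrange : ∀ φ v →
  (∀ k → v ⊛^ suc k ≗ diagonal φ (λ i → v ⊛^ (i + k))) →
  ∀ n k j → k + j ≡ n → n * (v ⊛^ k) j ≡ k * (φ ⊛^ n) j
lagrange φ v v≡ n zero zero refl = refl
lagrange φ v v≡ n zero (suc j) refl = *-zeroʳ j
-- Both sides are `φ 0`. This case stands apart because the next clause cancels the factor `m`.
lagrange φ v v≡ (suc zero) (suc zero) zero refl = cong (1 *_) (v≡ 0 0)
-- Every term of the diagonal has indices with sum `m`, so a factor `m` makes the induction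
-- hypothesis apply to it. The resulting factor `i + k` splits: `k` yields the power `φ ⊛^ suc m`,
-- and `i` yields `D φ ⊛ φ ⊛^ m`, which `D-⊛^` expresses through the same power.
lagrange φ v v≡ (suc m@(suc _)) (suc k) j e = *-cancelˡ-≡ _ _ m (begin
  m * (suc m * (v ⊛^ suc k) j)
    ≡⟨ cong (λ c → m * (suc m * c)) (v≡ k j) ⟩
  m * (suc m * ∑< (suc j) λ i → φ i * (v ⊛^ (i + k)) (j ∸ i))
    ≡⟨ swap m (suc m) (∑< (suc j) λ i → φ i * (v ⊛^ (i + k)) (j ∸ i)) ⟩
  suc m * (m * ∑< (suc j) λ i → φ i * (v ⊛^ (i + k)) (j ∸ i))
    ≡⟨ cong (suc m *_) (∑<-* (suc j) m (λ i → φ i * (v ⊛^ (i + k)) (j ∸ i))) ⟨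
  suc m * (∑< (suc j) λ i → m * (φ i * (v ⊛^ (i + k)) (j ∸ i)))
    ≡⟨ cong (suc m *_) (∑<-cong (suc j) λ {i} i≤j → begin
         m * (φ i * (v ⊛^ (i + k)) (j ∸ i))
           ≡⟨ swap m (φ i) _ ⟩
         φ i * (m * (v ⊛^ (i + k)) (j ∸ i))
           ≡⟨ cong (φ i *_) (lagrange φ v v≡ m (i + k) (j ∸ i) (index i (s≤s⁻¹ i≤j))) ⟩
         φ i * ((i + k) * (φ ⊛^ m) (j ∸ i))
           ≡⟨ expand (φ i) i k _ ⟩
         k * (φ i * (φ ⊛^ m) (j ∸ i)) + D φ i * (φ ⊛^ m) (j ∸ i) ∎) ⟩
  suc m * (∑< (suc j) λ i → k * (φ i * (φ ⊛^ m) (j ∸ i)) + D φ i * (φ ⊛^ m) (j ∸ i))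
    ≡⟨ cong (suc m *_) (∑<-+ (suc j) (λ i → k * (φ i * (φ ⊛^ m) (j ∸ i))) (λ i → D φ i * (φ ⊛^ m) (j ∸ i))) ⟩
  suc m * ((∑< (suc j) λ i → k * (φ i * (φ ⊛^ m) (j ∸ i))) + (D φ ⊛ φ ⊛^ m) j)
    ≡⟨ cong (λ c → suc m * (c + (D φ ⊛ φ ⊛^ m) j)) (∑<-* (suc j) k (λ i → φ i * (φ ⊛^ m) (j ∸ i))) ⟩
  suc m * (k * (φ ⊛^ suc m) j + (D φ ⊛ φ ⊛^ m) j)
    ≡⟨ *-distribˡ-+ (suc m) (k * (φ ⊛^ suc m) j) _ ⟩
  suc m * (k * (φ ⊛^ suc m) j) + suc m * (D φ ⊛ φ ⊛^ m) j
    ≡⟨ cong (suc m * (k * (φ ⊛^ suc m) j) +_) (D-⊛^ φ m j) ⟨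
  suc m * (k * (φ ⊛^ suc m) j) + j * (φ ⊛^ suc m) j
    ≡⟨ collect m k j ((φ ⊛^ suc m) j) ⟩
  (m * k + (k + j)) * (φ ⊛^ suc m) j
    ≡⟨ cong (λ c → (m * k + c) * (φ ⊛^ suc m) j) (suc-injective e) ⟩
  (m * k + m) * (φ ⊛^ suc m) j
    ≡⟨ finish m k ((φ ⊛^ suc m) j) ⟩
  m * (suc k * (φ ⊛^ suc m) j) ∎)
  where
  open ≡-Reasoning
  swap : ∀ a b c → a * (b * c) ≡ b * (a * c)
  swap = solve-∀
  expand : ∀ p i k q → p * ((i + k) * q) ≡ k * (p * q) + i * p * q
  expand = solve-∀
  collect : ∀ m k j q → suc m * (k * q) + j * q ≡ (m * k + (k + j)) * q
  collect = solve-∀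
  finish : ∀ m k q → (m * k + m) * q ≡ m * (suc k * q)
  finish = solve-∀
  index : ∀ i → i ≤ j → i + k + (j ∸ i) ≡ m
  index i i≤j = trans (cong (_+ (j ∸ i)) (+-comm i k)) (trans (+-assoc k i (j ∸ i))
    (trans (cong (k +_) (m+[n∸m]≡n i≤j)) (suc-injective e)))

-- Coefficients of the powers of (1 + x)² (2 + x)

linear : ℕ → Series
linear c = c · 𝟙 ⊕ x

linear-zero : ∀ c f → (linear c ⊛ f) 0 ≡ c * f 0
linear-zero c f = trans (⊛-zero (linear c) f) (cong (_* f 0) (trans (+-identityʳ (c * 1)) (*-identityʳ c)))

linear-suc : ∀ c f n → (linear c ⊛ f) (suc n) ≡ c * f (suc n) + f n
linear-suc c f n = trans (⊛-distribʳ-⊕ f (c · 𝟙) x (suc n)) (cong₂ _+_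
  (trans (·-⊛-assoc c 𝟙 f (suc n)) (cong (c *_) (⊛-identityˡ f (suc n)))) (x⊛-suc f n))

nC0≡1 : ∀ n → n C 0 ≡ 1
nC0≡1 n = trans (nCk≡nC[n∸k] {0} {n} z≤n) (nCn≡1 n)

binomial : ∀ c n j → (linear c ⊛^ n) j ≡ c ^ (n ∸ j) * (n C j)
binomial c zero    zero    = refl
binomial c zero    (suc j) = sym (cong (1 *_) (k>n⇒nCk≡0 {0} {suc j} (s≤s z≤n)))
binomial c (suc n) zero    = begin
  (linear c ⊛ linear c ⊛^ n) 0    ≡⟨ linear-zero c (linear c ⊛^ n) ⟩
  c * (linear c ⊛^ n) 0           ≡⟨ cong (c *_) (binomial c n 0) ⟩
  c * (c ^ n * (n C 0))           ≡⟨ *-assoc c (c ^ n) (n C 0) ⟨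
  c ^ suc n * (n C 0)             ≡⟨ cong (c ^ suc n *_) (trans (nC0≡1 n) (sym (nC0≡1 (suc n)))) ⟩
  c ^ suc n * (suc n C 0)         ∎
  where open ≡-Reasoning
binomial c (suc n) (suc j) = begin
  (linear c ⊛ linear c ⊛^ n) (suc j)
    ≡⟨ linear-suc c (linear c ⊛^ n) j ⟩
  c * (linear c ⊛^ n) (suc j) + (linear c ⊛^ n) j
    ≡⟨ cong₂ (λ u v → c * u + v) (binomial c n (suc j)) (binomial c n j) ⟩
  c * (c ^ (n ∸ suc j) * (n C suc j)) + c ^ (n ∸ j) * (n C j)
    ≡⟨ cong (_+ c ^ (n ∸ j) * (n C j)) absorb ⟩
  c ^ (n ∸ j) * (n C suc j) + c ^ (n ∸ j) * (n C j)
    ≡⟨ collect (c ^ (n ∸ j)) (n C suc j) (n C j) ⟩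
  c ^ (n ∸ j) * (n C j + n C suc j)
    ≡⟨ cong (c ^ (n ∸ j) *_) (nCk+nC[k+1]≡[n+1]C[k+1] n j) ⟩
  c ^ (n ∸ j) * (suc n C suc j) ∎
  where
  open ≡-Reasoning
  collect : ∀ a b d → a * b + a * d ≡ a * (d + b)
  collect = solve-∀
  absorb : c * (c ^ (n ∸ suc j) * (n C suc j)) ≡ c ^ (n ∸ j) * (n C suc j)
  absorb with suc j ≤? n
  ... | yes j<n = trans (sym (*-assoc c (c ^ (n ∸ suc j)) (n C suc j)))
    (cong (λ e → c ^ e * (n C suc j)) (sym (+-∸-assoc 1 j<n)))
  -- Both truncated exponents are 0 here, so the powers differ by a factor `c`, but the binomial
  -- coefficient vanishes.
  ... | no j≮n rewrite k>n⇒nCk≡0 {n} {suc j} (≰⇒> j≮n) =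
    trans (cong (c *_) (*-zeroʳ (c ^ (n ∸ suc j)))) (trans (*-zeroʳ c) (sym (*-zeroʳ (c ^ (n ∸ j)))))

-- (1 + w)² (2 + w)
φ : Series
φ 0 = 2
φ 1 = 5
φ 2 = 4
φ 3 = 1
φ _ = 0

φ-factors : φ ≗ linear 1 ⊛ (linear 1 ⊛ linear 2)
φ-factors 0 = refl
φ-factors 1 = refl
φ-factors 2 = refl
φ-factors 3 = refl
φ-factors (suc (suc (suc (suc n))))
  rewrite linear-suc 1 (linear 1 ⊛ linear 2) (3 + n)
        | linear-suc 1 (linear 2) (3 + n) | linear-suc 1 (linear 2) (2 + n) = refl

⊛^-cong : ∀ {f g} → f ≗ g → ∀ k → f ⊛^ k ≗ g ⊛^ k
⊛^-cong p zero    = λ _ → refl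
⊛^-cong p (suc k) = ⊛-cong p (⊛^-cong p k)

φ-power : ∀ n → φ ⊛^ n ≗ linear 1 ⊛^ (2 * n) ⊛ linear 2 ⊛^ n
φ-power zero = S.sym (⊛-identityˡ 𝟙)
φ-power (suc n) = begin
  φ ⊛ φ ⊛^ n
    ≈⟨ ⊛-cong φ-factors (φ-power n) ⟩
  l₁ ⊛ (l₁ ⊛ l₂) ⊛ (l₁ ⊛^ (2 * n) ⊛ l₂ ⊛^ n)
    ≈⟨ solve 4 (λ l₁ l₂ f g → l₁ :* (l₁ :* l₂) :* (f :* g) := l₁ :* (l₁ :* f) :* (l₂ :* g))
         S.refl l₁ l₂ (l₁ ⊛^ (2 * n)) (l₂ ⊛^ n) ⟩
  l₁ ⊛^ suc (suc (2 * n)) ⊛ l₂ ⊛^ suc n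
    ≡⟨ cong (λ m → l₁ ⊛^ m ⊛ l₂ ⊛^ suc n) (2*suc n) ⟨
  l₁ ⊛^ (2 * suc n) ⊛ l₂ ⊛^ suc n ∎
  where
  open SetoidReasoning S.setoid
  open SeriesSolver series using (solve; _:*_; _:=_)
  l₁ = linear 1
  l₂ = linear 2

-- The first factor in `φ-power` contributes the coefficient at `i`, the second the one at `n - i`,
-- which carries the power `2 ^ suc i`. Symmetry turns its binomial coefficient into
-- `suc n C suc i`, and one factor 2 moves in front of the sum.
φ-power-coefficient : ∀ n → (φ ⊛^ suc n) n ≡
  2 * ∑[ i < suc n ] (2 ^ i * ((2 * suc n) C i) * (suc n C suc i))
φ-power-coefficient n = begin
  (φ ⊛^ suc n) n
    ≡⟨ φ-power (suc n) n ⟩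
  ∑[ i < suc n ] ((linear 1 ⊛^ (2 * suc n)) i * (linear 2 ⊛^ suc n) (n ∸ i))
    ≡⟨ ∑<-cong (suc n) (λ {i} i≤n → term i (s≤s⁻¹ i≤n)) ⟩
  ∑[ i < suc n ] (2 * (2 ^ i * ((2 * suc n) C i) * (suc n C suc i)))
    ≡⟨ ∑<-* (suc n) 2 (λ i → 2 ^ i * ((2 * suc n) C i) * (suc n C suc i)) ⟩
  2 * ∑[ i < suc n ] (2 ^ i * ((2 * suc n) C i) * (suc n C suc i)) ∎
  where
  open ≡-Reasoning
  regroup : ∀ a b c → 1 * a * (2 * b * c) ≡ 2 * (b * a * c)
  regroup = solve-∀
  term : ∀ i → i ≤ n → (linear 1 ⊛^ (2 * suc n)) i * (linear 2 ⊛^ suc n) (n ∸ i) ≡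
    2 * (2 ^ i * ((2 * suc n) C i) * (suc n C suc i))
  term i i≤n = begin
    (linear 1 ⊛^ (2 * suc n)) i * (linear 2 ⊛^ suc n) (n ∸ i)
      ≡⟨ cong₂ _*_ (binomial 1 (2 * suc n) i) (binomial 2 (suc n) (n ∸ i)) ⟩
    1 ^ (2 * suc n ∸ i) * ((2 * suc n) C i) * (2 ^ (suc n ∸ (n ∸ i)) * (suc n C (n ∸ i)))
      ≡⟨ cong₂ (λ u v → u * ((2 * suc n) C i) * (2 ^ (suc n ∸ (n ∸ i)) * v))
           (^-zeroˡ (2 * suc n ∸ i)) (sym (nCk≡nC[n∸k] {suc i} {suc n} (s≤s i≤n))) ⟩
    1 * ((2 * suc n) C i) * (2 ^ (suc n ∸ (n ∸ i)) * (suc n C suc i))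
      ≡⟨ cong (λ e → 1 * ((2 * suc n) C i) * (2 ^ e * (suc n C suc i))) (m∸[m∸n]≡n {suc n} {suc i} (s≤s i≤n)) ⟩
    1 * ((2 * suc n) C i) * (2 ^ suc i * (suc n C suc i))
      ≡⟨ regroup ((2 * suc n) C i) (2 ^ i) (suc n C suc i) ⟩
    2 * (2 ^ i * ((2 * suc n) C i) * (suc n C suc i)) ∎

-- The functional equation and the explicit formula

module _ where
  private
    O v : Series
    O = oddTrees
    -- Chosen so that `R` is `x ⊛ v`; the equation R = x φ(R) becomes v = φ(x v), the form that
    -- `lagrange` takes.
    v = O ⊛^ 2 ⊕ O ⊛^ 3

  open SeriesSolver series using (solve; _:+_; _:*_; _:=_; con)

  O≗𝟙⊕x⊛v : O ≗ 𝟙 ⊕ x ⊛ v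
  O≗𝟙⊕x⊛v = S.trans oddTrees-equation (solve 2 (λ x O →
    con 1 :+ (x :* O :* O :+ x :* O :* O :* O) :=
    con 1 :+ x :* (O :* (O :* con 1) :+ O :* (O :* (O :* con 1)))) S.refl x O)

  r≡oddTrees : ∀ n → r n ≡ O n
  r≡oddTrees n = trans (cong ∣𝔄∣ (+-comm (2 * n) 1)) (∣𝔄∣-trees (trees false ℓ ℓ) (s≤s z≤n)
    (trees-unique false ℓ ℓ)
    (λ t∈ → let good , _ , size≡ = trees-sound false ℓ t∈ in good , size≡)
    (λ {t} good → complete t good))
    where
    ℓ = suc (2 * n)
    complete : ∀ t → Good t → size t ≡ ℓ → t ∈ trees false ℓ ℓ
    complete t good size≡ = subst (λ k → t ∈ trees false ℓ k) size≡
      (trees-complete false ℓ t good tt (≤-reflexive size≡))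

  R⊕𝟙≗O : R ⊕ 𝟙 ≗ O
  R⊕𝟙≗O zero    = refl
  R⊕𝟙≗O (suc n) = trans (+-identityʳ _) (r≡oddTrees (suc n))

  R≗x⊛v : R ≗ x ⊛ v
  R≗x⊛v n = +-cancelʳ-≡ (𝟙 n) (R n) ((x ⊛ v) n)
    (trans (R⊕𝟙≗O n) (trans (O≗𝟙⊕x⊛v n) (+-comm (𝟙 n) ((x ⊛ v) n))))

  R-equation : R ≗ x ⊛ (R ⊕ 𝟙) ⊛^ 2 ⊕ x ⊛ (R ⊕ 𝟙) ⊛^ 3
  R-equation = S.trans R≗x⊛v (S.trans (S.distribˡ x (O ⊛^ 2) (O ⊛^ 3)) (S.+-cong
    (S.*-congˡ {x} (⊛^-cong (S.sym R⊕𝟙≗O) 2)) (S.*-congˡ {x} (⊛^-cong (S.sym R⊕𝟙≗O) 3))))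

  -- `v` is O² (1 + O) with O = 1 + x v. Times `v ⊛^ k`, this expands to a Horner form in `x` with
  -- coefficients 2, 5, 4, 1, and four uses of `diagonal-suc` fold it into `diagonal φ`.
  v≗φ[xv] : ∀ k → v ⊛^ suc k ≗ diagonal φ (λ i → v ⊛^ (i + k))
  v≗φ[xv] k = begin
    v ⊛ A
      ≈⟨ S.*-congʳ {A} v≗ ⟩
    (𝟙 ⊕ x ⊛ v) ⊛ (𝟙 ⊕ x ⊛ v) ⊛ (𝟙 ⊕ (𝟙 ⊕ x ⊛ v)) ⊛ A
      ≈⟨ solve 3 (λ x v A →
           (con 1 :+ x :* v) :* (con 1 :+ x :* v) :* (con 1 :+ (con 1 :+ x :* v)) :* A :=
           A :+ A :+ x :* (v :* A :+ v :* A :+ v :* A :+ v :* A :+ v :* A :+ x :* (v :* (v :* A) :+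
             v :* (v :* A) :+ v :* (v :* A) :+ v :* (v :* A) :+ x :* (v :* (v :* (v :* A))))))
           S.refl x v A ⟩
    A ⊕ A ⊕ x ⊛ (B ⊕ B ⊕ B ⊕ B ⊕ B ⊕ x ⊛ (C′ ⊕ C′ ⊕ C′ ⊕ C′ ⊕ x ⊛ E))
      ≈⟨ S.+-cong (twice A) (S.*-congˡ {x} (S.+-cong (five B) (S.*-congˡ {x} (S.+-cong (four C′)
           (S.*-congˡ {x} (once E)))))) ⟩
    -- The final `x ⊛ 𝟘` stands for the coefficients of `φ` from the fourth power on, which are all
    -- 0.
    2 · A ⊕ x ⊛ (5 · B ⊕ x ⊛ (4 · C′ ⊕ x ⊛ (1 · E ⊕ x ⊛ 𝟘)))
      ≈⟨ S.+-congˡ {2 · A} (S.*-congˡ {x} (S.+-congˡ {5 · B} (S.*-congˡ {x} (S.+-congˡ {4 · C′} (S.*-congˡ {x}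
           (S.+-congˡ {1 · E} (S.*-congˡ {x} (diagonal-𝟘 (λ i → V (4 + i)))))))))) ⟨
    2 · A ⊕ x ⊛ (5 · B ⊕ x ⊛ (4 · C′ ⊕ x ⊛ (1 · E ⊕ x ⊛ diagonal 𝟘 (λ i → V (4 + i)))))
      ≈⟨ S.+-congˡ {2 · A} (S.*-congˡ {x} (S.+-congˡ {5 · B} (S.*-congˡ {x} (S.+-congˡ {4 · C′} (S.*-congˡ {x}
           (diagonal-suc (tail (tail (tail φ))) (λ i → V (3 + i)))))))) ⟨
    2 · A ⊕ x ⊛ (5 · B ⊕ x ⊛ (4 · C′ ⊕ x ⊛ diagonal (tail (tail (tail φ))) (λ i → V (3 + i))))
      ≈⟨ S.+-congˡ {2 · A} (S.*-congˡ {x} (S.+-congˡ {5 · B} (S.*-congˡ {x}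
           (diagonal-suc (tail (tail φ)) (λ i → V (2 + i)))))) ⟨
    2 · A ⊕ x ⊛ (5 · B ⊕ x ⊛ diagonal (tail (tail φ)) (λ i → V (2 + i)))
      ≈⟨ S.+-congˡ {2 · A} (S.*-congˡ {x} (diagonal-suc (tail φ) (λ i → V (1 + i)))) ⟨
    2 · A ⊕ x ⊛ diagonal (tail φ) (λ i → V (1 + i))
      ≈⟨ diagonal-suc φ V ⟨
    diagonal φ V ∎
    where
    open SetoidReasoning S.setoid
    V : ℕ → Series
    V i = v ⊛^ (i + k)
    A = V 0
    B = V 1
    C′ = V 2
    E = V 3
    v≗ : v ≗ (𝟙 ⊕ x ⊛ v) ⊛ (𝟙 ⊕ x ⊛ v) ⊛ (𝟙 ⊕ (𝟙 ⊕ x ⊛ v))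
    v≗ = S.trans (solve 1 (λ O → O :* (O :* con 1) :+ O :* (O :* (O :* con 1)) := O :* O :* (con 1 :+ O)) S.refl O)
      (⊛-cong (⊛-cong O≗𝟙⊕x⊛v O≗𝟙⊕x⊛v) (S.+-congˡ {𝟙} O≗𝟙⊕x⊛v))
    twice : ∀ f → f ⊕ f ≗ 2 · f
    twice f n = lemma (f n)
      where lemma : ∀ a → a + a ≡ 2 * a
            lemma = solve-∀
    four : ∀ f → f ⊕ f ⊕ f ⊕ f ≗ 4 · f
    four f n = lemma (f n)
      where lemma : ∀ a → a + a + a + a ≡ 4 * a
            lemma = solve-∀
    five : ∀ f → f ⊕ f ⊕ f ⊕ f ⊕ f ≗ 5 · f
    five f n = lemma (f n)
      where lemma : ∀ a → a + a + a + a + a ≡ 5 * a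
            lemma = solve-∀
    once : ∀ f → f ≗ 1 · f ⊕ x ⊛ 𝟘
    once f n = trans (sym (*-identityˡ (f n)))
      (sym (trans (cong (1 * f n +_) (S.zeroʳ x n)) (+-identityʳ (1 * f n))))

  n*r≡ : ∀ n → suc n * r (suc n) ≡ 2 * ∑[ i < suc n ] (2 ^ i * ((2 * suc n) C i) * (suc n C suc i))
  n*r≡ n = begin
    suc n * r (suc n)        ≡⟨ cong (suc n *_) (trans (R≗x⊛v (suc n)) (x⊛-suc v n)) ⟩
    suc n * v n              ≡⟨ cong (suc n *_) (S.*-identityʳ v n) ⟨
    suc n * (v ⊛^ 1) n       ≡⟨ lagrange φ v v≗φ[xv] (suc n) 1 n refl ⟩
    1 * (φ ⊛^ suc n) n       ≡⟨ *-identityˡ _ ⟩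
    (φ ⊛^ suc n) n           ≡⟨ φ-power-coefficient n ⟩
    2 * ∑[ i < suc n ] (2 ^ i * ((2 * suc n) C i) * (suc n C suc i)) ∎
    where open ≡-Reasoning

-- Opened only here because +_ makes sections of _+_ ambiguous.
open import Data.Integer.Base as ℤ using (+_)

-- Passing to unnormalised rationals makes the equality a cross multiplication, which is the
-- hypothesis up to factors 1.
quotient : ∀ a b c n → suc n * a ≡ b * c → + a / 1 ≡ (+ b / suc n) ℚ.* (+ c / 1)
quotient a b c n e = toℚᵘ-injective (begin
  toℚᵘ (+ a / 1)                           ≈⟨ toℚᵘ-fromℚᵘ (mkℚᵘ (+ a) 0) ⟩
  mkℚᵘ (+ a) 0                             ≈⟨ *≡* cross ⟩
  mkℚᵘ (+ b) n ℚᵘ.* mkℚᵘ (+ c) 0           ≈⟨ ℚᵘ.*-cong (toℚᵘ-fromℚᵘ (mkℚᵘ (+ b) n)) (toℚᵘ-fromℚᵘ (mkℚᵘ (+ c) 0)) ⟨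
  toℚᵘ (+ b / suc n) ℚᵘ.* toℚᵘ (+ c / 1)   ≈⟨ toℚᵘ-homo-* (+ b / suc n) (+ c / 1) ⟨
  toℚᵘ ((+ b / suc n) ℚ.* (+ c / 1))       ∎)
  where
  open ℚᵘ.≃-Reasoning
  cross : + a ℤ.* + (suc n * 1) ≡ + b ℤ.* + c ℤ.* + 1
  cross = trans (sym (ℤ.pos-* a (suc n * 1))) (trans
    (cong +_ (trans (trans (cong (a *_) (*-identityʳ (suc n))) (*-comm a (suc n))) e))
    (trans (ℤ.pos-* b c) (sym (ℤ.*-identityʳ (+ b ℤ.* + c)))))

theorem6p1 : (R ≗ x ⊛ (R ⊕ 𝟙) ⊛^ 2 ⊕ x ⊛ (R ⊕ 𝟙) ⊛^ 3) ×
    (r 0 ≡ 1) ×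
    ((n : ℕ) .{{_ : NonZero n}} →
    + r n / 1 ≡ (+ 2 / n) ℚ.* (+ (∑[ i < n ] (2 ^ i * ((2 * n) C i) * (n C suc i))) / 1))
theorem6p1 = R-equation , refl , λ { (suc n) → quotient (r (suc n)) 2
  (∑[ i < suc n ] (2 ^ i * ((2 * suc n) C i) * (suc n C suc i))) n (n*r≡ n) }
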